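{- There do not exist formulas of $L_{\omega_1\omega}$ in the language $\{<\}$ of linear orderings which, for every directed graph $G$, define an interpretation of $G$ in the linear ordering $L(G)$. That is, there is no fixed triple of $L_{\omega_1\omega}$-definitions of a set $D\subseteq L(G)^{<\omega}$ and relations $\sim$ and $E^*$ on $D$ such that, for every directed graph $G$, when evaluated in $L(G)$ they yield $D$, an equivalence relation $\sim$ on $D$ compatible with $E^*$, and $(D,E^*)/_{\sim}\cong G$.
   Context: A directed graph is a structure $G=(V,E)$ with $E$ a binary relation and universe $V\subseteq\omega$. Fix an effective partition $(A_n)_{n\in\omega}$ of $\mathbb{Q}$ into pairwise disjoint sets, each dense in $\mathbb{Q}$. Fix an effective list $(t_m)_{1\le m<\omega}$ of all atomic (complete quantifier-free) types in the language $\{E\}$ of tuples of distinct elements, where $t_1$ is the type of the empty tuple, followed by the types of single elements, then the types of pairs of distinct elements, then triples, etc. The Friedman–Stanley ordering $L(G)$ is the set of finite sequences of rationals $\sigma=r_0q_1r_1\ldots r_{n-1}q_nr_nk$ ($n\ge 0$) such that $r_i\in A_0$ for $i<n$, $r_n\in A_1$, there are distinct elements $a_1,\dots,a_n$ of $G$ with $q_i\in A_{a_i}$ for $1\le i\le n$ such that $(a_1,\dots,a_n)$ realizes $t_m$ in $G$, and $k$ is a natural number with $k<m$; $L(G)$ is ordered lexicographically. An $L_{\omega_1\omega}$-definition of a relation $R\subseteq \mathcal{B}^{<\omega}$ in a structure $\mathcal{B}$ is a countable sequence of $L_{\omega_1\omega}$ formulas $\varphi_n(\bar x_n)$ (with $\bar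 x_n$ of length $n$) such that $\varphi_n$ defines $R\cap\mathcal{B}^n$; relations on tuples of $D$ (of varying arities) are defined analogously. -}

module Defs where

open import Level using (0ℓ)
open import Data.Nat using (ℕ; zero; suc; _+_; _*_; _^_; _<_; _≤_; _%_; _/_)
open import Data.Nat.Divisibility using (_∣_)
open import Data.Integer using (+_)
open import Data.Fin using (Fin; toℕ) renaming (zero to fzero; suc to fsuc)
open import Data.List using (List; []; _∷_; [_]; _++_)
open import Data.List.Relation.Binary.Lex.Strict using (Lex-<)
open import Data.Rational using (ℚ) renaming (_/_ to _/ℚ_; _<_ to _<ℚ_)
import Data.Rational as Q
open import Data.Vec.Functional using () renaming (_++_ to _+++_)
open import Data.Product using (Σ; _×_; ∃; ∃-syntax; _,_; proj₁)
open import Data.Unit using (⊤)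
open import Data.Empty using (⊥)
open import Relation.Nullary using (¬_)
open import Relation.Binary.PropositionalEquality using (_≡_)
open import Function using (_∘_)
open import Function.Bundles using (_⇔_)

record Graph : Set₁ where
  field
    V    : ℕ → Set
    E    : ℕ → ℕ → Set
    E⊆V  : ∀ {a b} → E a b → V a × V b

-- The effective partition (A n) of ℚ into dense sets:
-- x ∈ A n  iff  the 2-adic valuation of the (reduced) denominator of x is n.

A : ℕ → ℚ → Set
A n x = (2 ^ n ∣ Q.ℚ.denominatorℕ x) × ¬ (2 ^ suc n ∣ Q.ℚ.denominatorℕ x)

-- The effective list (t m)_{m ≥ 1} of atomic types of tuples of distinct
-- elements in the language {E}.  An atomic type of an n-tuple of distinct
-- elements is determined by the truth values of E(x_i, x_k) for i,k < n,
-- i.e. by a number j < 2^(n·n) whose bit (i·n+k) records E(x_i,x_k).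
-- Types of n-tuples occupy the block of indices
--   1 + offset n , … , offset n + 2^(n·n)   where offset n = Σ_{i<n} 2^(i·i).
-- So t_1 is the type of the empty tuple, then the 2 types of singletons, …

offset : ℕ → ℕ
offset zero    = 0
offset (suc n) = offset n + 2 ^ (n * n)

bit : ℕ → ℕ → ℕ
bit j zero    = j % 2
bit j (suc b) = bit (j / 2) b

-- (a_1,…,a_n) (assumed distinct) realizes t_m in G
Realizes : (G : Graph) → ℕ → {n : ℕ} → (Fin n → ℕ) → Set
Realizes G m {n} as =
  ∃[ j ] (j < 2 ^ (n * n)) × (m ≡ suc (offset n + j)) ×
    (∀ (i k : Fin n) → Graph.E G (as i) (as k) ⇔ (bit j (toℕ i * n + toℕ k) ≡ 1))

interleave : {n : ℕ} → (Fin (suc n) → ℚ) → (Fin n → ℚ) → List ℚ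
interleave {zero}  rs qs = [ rs fzero ]
interleave {suc n} rs qs = rs fzero ∷ qs fzero ∷ interleave (rs ∘ fsuc) (qs ∘ fsuc)

last : {n : ℕ} → (Fin (suc n) → ℚ) → ℚ
last {zero}  rs = rs fzero
last {suc n} rs = last (rs ∘ fsuc)

initial : {n : ℕ} → Fin n → Fin (suc n)
initial fzero    = fzero
initial (fsuc i) = fsuc (initial i)

InL : Graph → List ℚ → Set
InL G σ =
  ∃[ n ] Σ (Fin (suc n) → ℚ) λ rs → Σ (Fin n → ℚ) λ qs →
  Σ (Fin n → ℕ) λ as → ∃[ m ] ∃[ k ]
    (σ ≡ interleave rs qs ++ [ + k /ℚ 1 ]) ×
    (∀ i → A 0 (rs (initial i))) ×
    A 1 (last rs) ×
    (∀ i j → as i ≡ as j → i ≡ j) ×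
    (∀ i → Graph.V G (as i)) ×
    (∀ i → A (as i) (qs i)) ×
    (1 ≤ m) × Realizes G m as × (k < m)

_<lex_ : List ℚ → List ℚ → Set
_<lex_ = Lex-< _≡_ _<ℚ_

record OrdStr : Set₁ where
  field
    Carrier : Set
    _≈_     : Carrier → Carrier → Set
    _≺_     : Carrier → Carrier → Set

L : Graph → OrdStr
L G = record
  { Carrier = Σ (List ℚ) (InL G)
  ; _≈_     = λ x y → proj₁ x ≡ proj₁ y
  ; _≺_     = λ x y → proj₁ x <lex proj₁ y
  }

data Formula (n : ℕ) : Set where
  tt     : Formula n
  _≐_    : Fin n → Fin n → Formula n
  _≺'_   : Fin n → Fin n → Formula n
  ¬'_    : Formula n → Formula n
  ⋀ ⋁    : (ℕ → Formula n) → Formula n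
  ∀' ∃'  : Formula (suc n) → Formula n

extend : {M : Set} {n : ℕ} → M → (Fin n → M) → Fin (suc n) → M
extend x ρ fzero    = x
extend x ρ (fsuc i) = ρ i

Sat : (𝓜 : OrdStr) {n : ℕ} → Formula n → (Fin n → OrdStr.Carrier 𝓜) → Set
Sat 𝓜 tt        ρ = ⊤
Sat 𝓜 (i ≐ j)   ρ = OrdStr._≈_ 𝓜 (ρ i) (ρ j)
Sat 𝓜 (i ≺' j)  ρ = OrdStr._≺_ 𝓜 (ρ i) (ρ j)
Sat 𝓜 (¬' φ)    ρ = ¬ Sat 𝓜 φ ρ
Sat 𝓜 (⋀ φs)    ρ = ∀ i → Sat 𝓜 (φs i) ρ
Sat 𝓜 (⋁ φs)    ρ = ∃[ i ] Sat 𝓜 (φs i) ρ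
Sat 𝓜 (∀' φ)    ρ = ∀ x → Sat 𝓜 φ (extend x ρ)
Sat 𝓜 (∃' φ)    ρ = ∃[ x ] Sat 𝓜 φ (extend x ρ)

DefSet : Set
DefSet = (n : ℕ) → Formula n

DefRel : Set
DefRel = (n m : ℕ) → Formula (n + m)

Tuple : OrdStr → Set
Tuple 𝓜 = ∃[ n ] (Fin n → OrdStr.Carrier 𝓜)

evalSet : (𝓜 : OrdStr) → DefSet → Tuple 𝓜 → Set
evalSet 𝓜 φ (n , x) = Sat 𝓜 (φ n) x

evalRel : (𝓜 : OrdStr) → DefRel → Tuple 𝓜 → Tuple 𝓜 → Set
evalRel 𝓜 ψ (n , x) (m , y) = Sat 𝓜 (ψ n m) (x +++ y)

-- (D, ∼, E*) defines an interpretation of G in 𝓜: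
-- ∼ and E* are relations on D, ∼ is an equivalence relation on D compatible
-- with E*, and (D, E*)/∼ ≅ G, the latter expressed by a map f : D → V which
-- is onto V, has kernel ∼, and pulls E back to E*.

IsInterpretation : (G : Graph) (𝓜 : OrdStr) → DefSet → DefRel → DefRel → Set
IsInterpretation G 𝓜 φD ψ∼ ψE =
  let D   = evalSet 𝓜 φD
      _∼_ = evalRel 𝓜 ψ∼
      E*  = evalRel 𝓜 ψE
      V   = Graph.V G
      E   = Graph.E G
  in
  (∀ x y → x ∼ y → D x × D y) ×
  (∀ x y → E* x y → D x × D y) ×
  (∀ x → D x → x ∼ x) ×
  (∀ x y → x ∼ y → y ∼ x) ×
  (∀ x y z → x ∼ y → y ∼ z → x ∼ z) ×
  (∀ x x′ y y′ → x ∼ x′ → y ∼ y′ → E* x y → E* x′ y′) ×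
  (Σ ((x : Tuple 𝓜) → D x → ℕ) λ f →
     (∀ x dx → V (f x dx)) ×
     (∀ v → V v → ∃[ x ] Σ (D x) λ dx → f x dx ≡ v) ×
     (∀ x y (dx : D x) (dy : D y) → (x ∼ y) ⇔ (f x dx ≡ f y dy)) ×
     (∀ x y (dx : D x) (dy : D y) → E* x y ⇔ E (f x dx) (f y dy)))

{-# OPTIONS --safe #-}

-- Ordinals in Cantor normal form whose exponents are the nodes of a well-founded tree W, ordered as by
-- Kleene and Brouwer, give two graphs: the ordinals below ω^t, where t is the root of W, and the
-- ordinals below ω^t·ω, with E the order relation.  Matching ordinals up to non-zero multiples of
-- ω^w, for nodes w descending through W, is a back-and-forth system between the two graphs; it lifts
-- to their Friedman-Stanley orderings, and if W is built from the ranks of the given formulas, the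
-- formulas cannot tell matched tuples apart.  If x is matched with x′, y with y′, and every word of x
-- lies to the left of every word of y, with a smaller first letter, and likewise for x′ and y′, then
-- the concatenated tuples are matched too.  Adding an integer to the first letters moves a tuple past
-- any other one; it does not change the vertex which the tuple represents, since translating it
-- repeatedly would otherwise produce an infinite descending sequence of ordinals.  So matched pairs
-- of tuples induce an order preserving correspondence of vertices in which every ordinal below ω^t·ω
-- has a counterpart below ω^t.  Iterating it from ω^t gives an infinite descending sequence.

module Submission where

open import Defs
open import Data.Bool using (Bool; true; false)
open import Data.Empty using (⊥; ⊥-elim)
open import Data.Fin using (Fin; splitAt) renaming (zero to fzero; suc to fsuc)
open import Data.Integer as ℤ using (ℤ; +_; -[1+_])
import Data.Integer.DivMod as ℤ/
open import Data.Integer.Divisibility.Signed as ℤ∣ using (∣ᵤ⇒∣; ∣⇒∣ᵤ)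
import Data.Integer.Properties as ℤₚ
open import Data.Integer.Tactic.RingSolver using (solve-∀)
open import Data.List using (List; []; _∷_; _++_; [_]; map; tabulate; filter)
open import Data.List.Membership.Propositional using (_∈_; find; lose)
open import Data.List.Membership.Propositional.Properties
  using (∈-map⁺; ∈-map⁻; ∈-filter⁺; ∈-filter⁻; ∈-tabulate⁺; ∈-tabulate⁻)
open import Data.List.Properties using (++-identityʳ; ++-assoc)
open import Data.List.Relation.Binary.Lex.Strict using (base; this; next)
open import Data.List.Relation.Unary.All as All using (All; []; _∷_)
import Data.List.Relation.Unary.All.Properties as Allₚ
open import Data.List.Relation.Unary.AllPairs using (AllPairs; []; _∷_)
open import Data.List.Relation.Unary.Any using (here; there; any?)
open import Data.Nat as ℕ using (ℕ; zero; suc; _^_)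
open import Data.Nat.Coprimality using (Coprime; coprime-divisor)
open import Data.Nat.Divisibility as ℕ∣ using () renaming (_∣_ to _∣ⁿ_)
import Data.Nat.GCD as ℕgcd
import Data.Nat.Induction as ℕᵢ
import Data.Nat.Properties as ℕₚ
open import Data.Product using (Σ; _×_; _,_; ∃; ∃-syntax; proj₁; proj₂; swap)
open import Data.Rational as Q using (ℚ; mkℚ)
import Data.Rational.Properties as Qₚ
open import Data.Rational.Unnormalised as ℚᵘ using (mkℚᵘ)
import Data.Rational.Unnormalised.Properties as ℚᵘₚ
open import Data.Sum using (_⊎_; inj₁; inj₂)
open import Data.Unit using (⊤)
open import Data.Vec.Functional using () renaming (_++_ to _+++_; _∷_ to _◂_)
open import Function using (_∘_; case_of_)
open import Function.Bundles using (_⇔_; mk⇔; Equivalence)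
open import Induction.WellFounded using (Acc; acc; WellFounded)
open import Relation.Binary.Definitions using (tri<; tri≈; tri>)
open import Relation.Binary.PropositionalEquality
  using (_≡_; refl; sym; trans; cong; cong₂; subst; module ≡-Reasoning)
open import Relation.Nullary using (¬_; yes; no)

-- The colour classes A n

^-∣ : ∀ a {m n} → m ℕ.≤ n → a ^ m ∣ⁿ a ^ n
^-∣ a {m} m≤n with ℕₚ.m≤n⇒∃[o]m+o≡n m≤n
... | o , refl = subst (a ^ m ∣ⁿ_) (sym (ℕₚ.^-distribˡ-+-* a m o)) (ℕ∣.m∣m*n (a ^ o))

A-unique : ∀ {m n q} → A m q → A n q → m ≡ n
A-unique {m} {n} (dm , ndm) (dn , ndn) with ℕₚ.<-cmp m n
... | tri< m<n _ _ = ⊥-elim (ndm (ℕ∣.∣-trans (^-∣ 2 m<n) dn))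
... | tri≈ _ e _   = e
... | tri> _ _ n<m = ⊥-elim (ndn (ℕ∣.∣-trans (^-∣ 2 n<m) dm))

A₀₁-disjoint : ∀ {q} → A 0 q → ¬ A 1 q
A₀₁-disjoint {q} a b with () ← A-unique {0} {1} {q} a b

infixl 6 _⊕ᶻ_
_⊕ᶻ_ : ℚ → ℤ → ℚ
q ⊕ᶻ k = q Q.+ (k Q./ 1)

-- Passing from `n / d` to `(n + k·d) / d` keeps the fraction reduced. Hence translation by an
-- integer preserves every colour class.
⊕ᶻ-denominator : ∀ q k → ℚ.denominatorℕ (q ⊕ᶻ k) ≡ ℚ.denominatorℕ q
⊕ᶻ-denominator q@(mkℚ n d-1 c) k = cong ℚ.denominatorℕ (Qₚ.toℚᵘ-injective {q ⊕ᶻ k} {r} eq)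
  where
  d = suc d-1
  coprime : Coprime ℤ.∣ n ∣ d → Coprime ℤ.∣ n ℤ.+ k ℤ.* + d ∣ d
  coprime c {i} (a , b) = c (i∣n , b)
    where
    i∣n : i ∣ⁿ ℤ.∣ n ∣
    i∣n = ∣⇒∣ᵤ {+ i} {n} (ℤ∣.∣m+n∣n⇒∣m {+ i} {n} (∣ᵤ⇒∣ {+ i} {n ℤ.+ k ℤ.* + d} a)
                                        (ℤ∣.∣n⇒∣m*n k (∣ᵤ⇒∣ {+ i} {+ d} b)))
  r : ℚ
  r = mkℚ (n ℤ.+ k ℤ.* + d) d-1 (coprime c)
  cross : ∀ n k d → (n ℤ.* + 1 ℤ.+ k ℤ.* d) ℤ.* d ≡ (n ℤ.+ k ℤ.* d) ℤ.* (d ℤ.* + 1)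
  cross = solve-∀
  eq : Q.toℚᵘ (q ⊕ᶻ k) ℚᵘ.≃ Q.toℚᵘ r
  eq = ℚᵘₚ.≃-trans (Qₚ.toℚᵘ-homo-+ q (k Q./ 1))
      (ℚᵘₚ.≃-trans (ℚᵘₚ.+-congʳ (mkℚᵘ n d-1) (Qₚ.toℚᵘ-fromℚᵘ (mkℚᵘ k 0)))
                   (ℚᵘ.*≡* (cross n k (+ d))))

A-⊕ᶻ : ∀ m q k → A m q → A m (q ⊕ᶻ k)
A-⊕ᶻ m q k (d , nd) rewrite ⊕ᶻ-denominator q k = d , nd

odd : ∀ u → ¬ (2 ∣ⁿ ℤ.∣ + 1 ℤ.+ + 2 ℤ.* u ∣)
odd u 2∣ with ∣⇒∣ᵤ {+ 2} {+ 1} (ℤ∣.∣m+n∣n⇒∣m {+ 2} {+ 1} (∣ᵤ⇒∣ {+ 2} {+ 1 ℤ.+ + 2 ℤ.* u} 2∣)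
                                             (ℤ∣.∣m⇒∣m*n u (ℤ∣.∣-refl {+ 2})))
... | 2∣1 with ℕ∣.∣1⇒≡1 2∣1
... | ()

odd-suc-double : ∀ e → ¬ (2 ∣ⁿ suc (2 ℕ.* e))
odd-suc-double e 2∣ with ℕ∣.∣1⇒≡1 (ℕ∣.∣m+n∣m⇒∣n (subst (2 ∣ⁿ_) (ℕₚ.+-comm 1 (2 ℕ.* e)) 2∣) (ℕ∣.m∣m*n e))
... | ()

coprime-2^ : ∀ m {g} → ¬ (2 ∣ⁿ g) → Coprime (2 ^ m) g
coprime-2^ zero    _ (i∣1 , _) = ℕ∣.∣1⇒≡1 i∣1
coprime-2^ (suc m) {g} ¬2∣g {i} (i∣ , i∣g) = coprime-2^ m ¬2∣g (coprime-divisor {i} {2} {2 ^ m} i⊥2 i∣ , i∣g)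
  where
  i⊥2 : Coprime i 2
  i⊥2 {0} (_ , 0∣2) with () ← ℕ∣.0∣⇒≡0 0∣2
  i⊥2 {1} _           = refl
  i⊥2 {2} (2∣i , _)   = ⊥-elim (¬2∣g (ℕ∣.∣-trans 2∣i i∣g))
  i⊥2 {suc (suc (suc _))} (_ , j∣2) with ℕ.s≤s (ℕ.s≤s ()) ← ℕ∣.∣⇒≤ j∣2

-- Cancelling against an odd numerator keeps the whole power of 2 in the denominator.
A-/ : ∀ m w-1 z (let N-1 = ℕ.pred (2 ^ m ℕ.* suc w-1)) →
      ¬ (2 ∣ⁿ ℤ.∣ z ∣) → ¬ (2 ∣ⁿ suc w-1) → suc N-1 ≡ 2 ^ m ℕ.* suc w-1 →
      A m (z Q./ suc N-1)
A-/ m w-1 z oddz oddw eqN = 2^m∣ , λ 2^sm∣ → oddw (ℕ∣.*-cancelˡ-∣ (2 ^ m) {{ℕₚ.m^n≢0 2 m}}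
    (subst (_∣ⁿ 2 ^ m ℕ.* suc w-1) (ℕₚ.*-comm 2 (2 ^ m))
      (subst (2 ^ suc m ∣ⁿ_) (trans d*g eqN) (ℕ∣.∣m⇒∣m*n g 2^sm∣))))
  where
  N = suc (ℕ.pred (2 ^ m ℕ.* suc w-1))
  g = ℕgcd.gcd ℤ.∣ z ∣ N
  d = ℚ.denominatorℕ (z Q./ N)
  d*g : d ℕ.* g ≡ N
  d*g = ℤₚ.+-injective (trans (ℤₚ.pos-* d g) (Qₚ.↧-/ z N))
  oddg : ¬ (2 ∣ⁿ g)
  oddg 2∣g = oddz (ℕ∣.∣-trans 2∣g (ℕgcd.gcd[m,n]∣m ℤ.∣ z ∣ N))
  2^m∣ : 2 ^ m ∣ⁿ d
  2^m∣ = coprime-divisor (coprime-2^ m oddg)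
    (subst (2 ^ m ∣ⁿ_) (trans (sym eqN) (trans (sym d*g) (ℕₚ.*-comm d g))) (ℕ∣.m∣m*n (suc w-1)))

-- For `p = a/b` and `q = c/d` the witness is an odd numerator over `N = 2^m·(6bd + 1)`. It exceeds
-- `p` by at most `3/N`, which is less than `1/(bd)`, while `q - p` is at least `1/(bd)`.
A-dense : ∀ m {p q} → p Q.< q → ∃ λ v → A m v × p Q.< v × v Q.< q
A-dense m {p@(mkℚ a b-1 _)} {q@(mkℚ c d-1 _)} (Q.*<* ad<cb) =
  v , A-/ m w-1 z (odd u) (odd-suc-double e) eqN , p<v , v<q
  where
  b = suc b-1
  d = suc d-1
  e = 3 ℕ.* (b ℕ.* d)
  w-1 = 2 ℕ.* e
  instance
    2^m≢0 : ℕ.NonZero (2 ^ m)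
    2^m≢0 = ℕₚ.m^n≢0 2 m
    N≢0 : ℕ.NonZero (2 ^ m ℕ.* suc w-1)
    N≢0 = ℕₚ.m*n≢0 (2 ^ m) (suc w-1)
  N-1 = ℕ.pred (2 ^ m ℕ.* suc w-1)
  N = suc N-1
  eqN : N ≡ 2 ^ m ℕ.* suc w-1
  eqN = ℕₚ.suc-pred (2 ^ m ℕ.* suc w-1)
  e<N : e ℕ.< N
  e<N = begin-strict
    e                    <⟨ ℕ.s≤s (ℕₚ.m≤m+n e _) ⟩
    suc w-1              ≤⟨ ℕₚ.m≤n*m (suc w-1) (2 ^ m) ⟩
    2 ^ m ℕ.* suc w-1    ≡⟨ eqN ⟨
    N                    ∎
    where open ℕₚ.≤-Reasoning
  aN = a ℤ.* + N
  2b = + 2 ℤ.* + b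
  t = aN ℤ./ 2b
  r = aN ℤ.% 2b
  -- Since `2bt ≤ aN < 2b(t + 1)`, the odd number `z = 2t + 3` satisfies `aN < zb ≤ aN + 3b`.
  u = t ℤ.+ + 1
  z = + 1 ℤ.+ + 2 ℤ.* u
  v = z Q./ N
  aN≡ : aN ≡ + r ℤ.+ t ℤ.* 2b
  aN≡ = ℤ/.a≡a%n+[a/n]*n aN 2b
  aN<zb : aN ℤ.< z ℤ.* + b
  aN<zb = begin-strict
    aN                              ≡⟨ aN≡ ⟩
    + r ℤ.+ t ℤ.* 2b                <⟨ ℤₚ.+-monoˡ-< (t ℤ.* 2b) (ℤ.+<+ (ℤ/.n%d<d aN 2b)) ⟩
    2b ℤ.+ t ℤ.* 2b                 ≡⟨ ℤₚ.+-identityˡ _ ⟨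
    + 0 ℤ.+ (2b ℤ.+ t ℤ.* 2b)       ≤⟨ ℤₚ.+-monoˡ-≤ (2b ℤ.+ t ℤ.* 2b) (ℤ.+≤+ ℕ.z≤n) ⟩
    + b ℤ.+ (2b ℤ.+ t ℤ.* 2b)       ≡⟨ lem (+ b) t ⟩
    z ℤ.* + b                       ∎
    where
    open ℤₚ.≤-Reasoning
    lem : ∀ b t → b ℤ.+ (+ 2 ℤ.* b ℤ.+ t ℤ.* (+ 2 ℤ.* b)) ≡ (+ 1 ℤ.+ + 2 ℤ.* (t ℤ.+ + 1)) ℤ.* b
    lem = solve-∀
  zb≤ : z ℤ.* + b ℤ.≤ aN ℤ.+ + 3 ℤ.* + b
  zb≤ = begin
    z ℤ.* + b                               ≡⟨ lem (+ b) t ⟩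
    + 0 ℤ.+ (t ℤ.* 2b ℤ.+ + 3 ℤ.* + b)      ≤⟨ ℤₚ.+-monoˡ-≤ (t ℤ.* 2b ℤ.+ + 3 ℤ.* + b) (ℤ.+≤+ (ℕ.z≤n {r})) ⟩
    + r ℤ.+ (t ℤ.* 2b ℤ.+ + 3 ℤ.* + b)      ≡⟨ ℤₚ.+-assoc (+ r) (t ℤ.* 2b) (+ 3 ℤ.* + b) ⟨
    + r ℤ.+ t ℤ.* 2b ℤ.+ + 3 ℤ.* + b        ≡⟨ cong (ℤ._+ + 3 ℤ.* + b) aN≡ ⟨
    aN ℤ.+ + 3 ℤ.* + b                      ∎
    where
    open ℤₚ.≤-Reasoning
    lem : ∀ b t → (+ 1 ℤ.+ + 2 ℤ.* (t ℤ.+ + 1)) ℤ.* b ≡ + 0 ℤ.+ (t ℤ.* (+ 2 ℤ.* b) ℤ.+ + 3 ℤ.* b)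
    lem = solve-∀
  zd<cN : z ℤ.* + d ℤ.< c ℤ.* + N
  zd<cN = ℤₚ.*-cancelʳ-<-nonNeg (+ b) (begin-strict
    z ℤ.* + d ℤ.* + b                                   ≡⟨ swapʳ z (+ d) (+ b) ⟩
    z ℤ.* + b ℤ.* + d                                   ≤⟨ ℤₚ.*-monoʳ-≤-nonNeg (+ d) zb≤ ⟩
    (aN ℤ.+ + 3 ℤ.* + b) ℤ.* + d                        ≡⟨ expand a (+ N) (+ b) (+ d) ⟩
    a ℤ.* + d ℤ.* + N ℤ.+ + 3 ℤ.* (+ b ℤ.* + d)         ≡⟨ cong (λ s → a ℤ.* + d ℤ.* + N ℤ.+ + 3 ℤ.* s) (sym (ℤₚ.pos-* b d)) ⟩
    a ℤ.* + d ℤ.* + N ℤ.+ + 3 ℤ.* + (b ℕ.* d)           ≡⟨ cong (λ s → a ℤ.* + d ℤ.* + N ℤ.+ s) (sym (ℤₚ.pos-* 3 (b ℕ.* d))) ⟩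
    a ℤ.* + d ℤ.* + N ℤ.+ + e                           <⟨ ℤₚ.+-monoʳ-< (a ℤ.* + d ℤ.* + N) (ℤ.+<+ e<N) ⟩
    a ℤ.* + d ℤ.* + N ℤ.+ + N                           ≡⟨ collect (a ℤ.* + d) (+ N) ⟩
    (+ 1 ℤ.+ a ℤ.* + d) ℤ.* + N                         ≤⟨ ℤₚ.*-monoʳ-≤-nonNeg (+ N) (ℤₚ.i<j⇒suc[i]≤j ad<cb) ⟩
    c ℤ.* + b ℤ.* + N                                   ≡⟨ swapʳ c (+ b) (+ N) ⟩
    c ℤ.* + N ℤ.* + b                                   ∎)
    where
    open ℤₚ.≤-Reasoning
    swapʳ : ∀ x y w → x ℤ.* y ℤ.* w ≡ x ℤ.* w ℤ.* y
    swapʳ = solve-∀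
    expand : ∀ a N b d → (a ℤ.* N ℤ.+ + 3 ℤ.* b) ℤ.* d ≡ a ℤ.* d ℤ.* N ℤ.+ + 3 ℤ.* (b ℤ.* d)
    expand = solve-∀
    collect : ∀ x N → x ℤ.* N ℤ.+ N ≡ (+ 1 ℤ.+ x) ℤ.* N
    collect = solve-∀
  v≃ : Q.toℚᵘ v ℚᵘ.≃ mkℚᵘ z N-1
  v≃ = Qₚ.toℚᵘ-fromℚᵘ (mkℚᵘ z N-1)
  p<v : p Q.< v
  p<v = Qₚ.toℚᵘ-cancel-< (ℚᵘₚ.<-respʳ-≃ (ℚᵘₚ.≃-sym v≃) (ℚᵘ.*<* aN<zb))
  v<q : v Q.< q
  v<q = Qₚ.toℚᵘ-cancel-< (ℚᵘₚ.<-respˡ-≃ (ℚᵘₚ.≃-sym v≃) (ℚᵘ.*<* zd<cN))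

-- Integer translations and finite cuts of ℚ

bound : ∀ q → ∃ λ K → q Q.< (+ K Q./ 1)
bound q@(mkℚ n d-1 _) = K , Qₚ.toℚᵘ-cancel-< (ℚᵘₚ.<-respʳ-≃ (ℚᵘₚ.≃-sym (Qₚ.toℚᵘ-fromℚᵘ (mkℚᵘ (+ K) 0))) (ℚᵘ.*<* n<))
  where
  K = suc ℤ.∣ n ∣
  n< : n ℤ.* + 1 ℤ.< + K ℤ.* + suc d-1
  n< = begin-strict
    n ℤ.* + 1             ≡⟨ ℤₚ.*-identityʳ n ⟩
    n                     ≤⟨ i≤∣i∣ n ⟩
    + ℤ.∣ n ∣             <⟨ ℤ.+<+ (ℕₚ.n<1+n ℤ.∣ n ∣) ⟩
    + K                   ≤⟨ ℤ.+≤+ (ℕₚ.m≤m*n K (suc d-1)) ⟩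
    + (K ℕ.* suc d-1)     ≡⟨ ℤₚ.pos-* K (suc d-1) ⟩
    + K ℤ.* + suc d-1     ∎
    where
    open ℤₚ.≤-Reasoning
    i≤∣i∣ : ∀ i → i ℤ.≤ + ℤ.∣ i ∣
    i≤∣i∣ (+ n)    = ℤₚ.≤-refl
    i≤∣i∣ -[1+ n ] = ℤ.-≤+

/1-homo-+ : ∀ i j → (i ℤ.+ j) Q./ 1 ≡ (i Q./ 1) Q.+ (j Q./ 1)
/1-homo-+ i j = Qₚ.toℚᵘ-injective {(i ℤ.+ j) Q./ 1} {(i Q./ 1) Q.+ (j Q./ 1)}
  (ℚᵘₚ.≃-trans (Qₚ.toℚᵘ-fromℚᵘ (mkℚᵘ (i ℤ.+ j) 0))
  (ℚᵘₚ.≃-trans (ℚᵘ.*≡* (cross i j))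
  (ℚᵘₚ.≃-sym (ℚᵘₚ.≃-trans (Qₚ.toℚᵘ-homo-+ (i Q./ 1) (j Q./ 1))
    (ℚᵘₚ.+-cong (Qₚ.toℚᵘ-fromℚᵘ (mkℚᵘ i 0)) (Qₚ.toℚᵘ-fromℚᵘ (mkℚᵘ j 0)))))))
  where
  cross : ∀ i j → (i ℤ.+ j) ℤ.* + 1 ≡ (i ℤ.* + 1 ℤ.+ j ℤ.* + 1) ℤ.* + 1
  cross = solve-∀

⊕ᶻ-assoc : ∀ q i j → (q ⊕ᶻ i) ⊕ᶻ j ≡ q ⊕ᶻ (i ℤ.+ j)
⊕ᶻ-assoc q i j = trans (Qₚ.+-assoc q (i Q./ 1) (j Q./ 1)) (cong (q Q.+_) (sym (/1-homo-+ i j)))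

⊕ᶻ-mono-< : ∀ {p q} k → p Q.< q → p ⊕ᶻ k Q.< q ⊕ᶻ k
⊕ᶻ-mono-< k = Qₚ.+-monoˡ-< (k Q./ 1)

/1-mono-≤ : ∀ {K L} → K ℕ.≤ L → (+ K Q./ 1) Q.≤ (+ L Q./ 1)
/1-mono-≤ {K} {L} K≤L = Qₚ.toℚᵘ-cancel-≤
  (ℚᵘₚ.≤-respˡ-≃ (ℚᵘₚ.≃-sym (Qₚ.toℚᵘ-fromℚᵘ (mkℚᵘ (+ K) 0)))
  (ℚᵘₚ.≤-respʳ-≃ (ℚᵘₚ.≃-sym (Qₚ.toℚᵘ-fromℚᵘ (mkℚᵘ (+ L) 0)))
    (ℚᵘ.*≤* (ℤₚ.*-monoʳ-≤-nonNeg (+ 1) (ℤ.+≤+ K≤L)))))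

overtake : ∀ p q → ∃ λ K → ∀ L → K ℕ.≤ L → p Q.< q ⊕ᶻ + L
overtake p q with bound (p Q.- q)
... | K , p-q<K = K , λ L K≤L → Qₚ.<-≤-trans p<q+K (Qₚ.+-monoʳ-≤ q (/1-mono-≤ K≤L))
  where
  p<q+K : p Q.< q ⊕ᶻ + K
  p<q+K = subst (Q._< q ⊕ᶻ + K) (begin
    q Q.+ (p Q.- q)         ≡⟨ Qₚ.+-comm q (p Q.- q) ⟩
    p Q.- q Q.+ q           ≡⟨ Qₚ.+-assoc p (Q.- q) q ⟩
    p Q.+ (Q.- q Q.+ q)     ≡⟨ cong (p Q.+_) (Qₚ.+-inverseˡ q) ⟩
    p Q.+ Q.0ℚ              ≡⟨ Qₚ.+-identityʳ p ⟩
    p                       ∎) (Qₚ.+-monoʳ-< q p-q<K)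
    where open ≡-Reasoning

strictly-below : ∀ q → q ⊕ᶻ ℤ.- + 1 Q.< q
strictly-below q = subst (q ⊕ᶻ ℤ.- + 1 Q.<_) (Qₚ.+-identityʳ q) (Qₚ.+-monoʳ-< q (Q.*<* ℤ.-<+))

strictly-above : ∀ q → q Q.< q ⊕ᶻ + 1
strictly-above q = subst (Q._< q ⊕ᶻ + 1) (Qₚ.+-identityʳ q) (Qₚ.+-monoʳ-< q (Q.*<* (ℤ.+<+ (ℕ.s≤s ℕ.z≤n))))

lower : ∀ ls us → (∀ {l u} → l ∈ ls → u ∈ us → l Q.< u) →
        ∃ λ z → (∀ {l} → l ∈ ls → l Q.≤ z) × (∀ {u} → u ∈ us → z Q.< u)
lower [] [] _ = Q.0ℚ , (λ ()) , λ ()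
lower [] (u ∷ us) _ with lower [] us (λ ())
... | z , _ , z< = z Q.⊓ (u ⊕ᶻ ℤ.- + 1) , (λ ()) , λ where
  (here refl) → Qₚ.≤-<-trans (Qₚ.p⊓q≤q z _) (strictly-below u)
  (there i)   → Qₚ.≤-<-trans (Qₚ.p⊓q≤p z _) (z< i)
lower (l ∷ ls) us l<u with lower ls us (l<u ∘ there)
... | z , ≤z , z< = l Q.⊔ z
  , (λ { (here refl) → Qₚ.p≤p⊔q l z ; (there i) → Qₚ.≤-trans (≤z i) (Qₚ.p≤q⊔p l z) })
  , λ u∈ → case Qₚ.⊔-sel l z of λ where
      (inj₁ e) → subst (Q._< _) (sym e) (l<u (here refl) u∈)
      (inj₂ e) → subst (Q._< _) (sym e) (z< u∈)

upper : ∀ z us → (∀ {u} → u ∈ us → z Q.< u) → ∃ λ t → z Q.< t × (∀ {u} → u ∈ us → t Q.≤ u)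
upper z [] _ = z ⊕ᶻ + 1 , strictly-above z , λ ()
upper z (u ∷ us) z< with upper z us (z< ∘ there)
... | t , z<t , t≤ = u Q.⊓ t
  , (case Qₚ.⊓-sel u t of λ where
      (inj₁ e) → subst (z Q.<_) (sym e) (z< (here refl))
      (inj₂ e) → subst (z Q.<_) (sym e) z<t)
  , λ { (here refl) → Qₚ.p⊓q≤p u t ; (there i) → Qₚ.≤-trans (Qₚ.p⊓q≤q u t) (t≤ i) }

-- One-point extension in a coloured dense order. The maximum of `ls` may itself be the bound found
-- by `lower`; density of the colour class restores strictness.
A-between : ∀ m ls us → (∀ {l u} → l ∈ ls → u ∈ us → l Q.< u) →
            ∃ λ v → A m v × (∀ {l} → l ∈ ls → l Q.< v) × (∀ {u} → u ∈ us → v Q.< u)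
A-between m ls us l<u with lower ls us l<u
... | z , ≤z , z< with upper z us z<
...   | t , z<t , t≤ with A-dense m z<t
...     | v , v∈ , z<v , v<t =
  v , v∈ , (λ i → Qₚ.≤-<-trans (≤z i) z<v) , λ i → Qₚ.<-≤-trans v<t (t≤ i)

-- Trees, nodes and available descents

data Ord : Set where
  leaf : Ord
  sup  : (ℕ → Ord) → Ord

data Node : Ord → Set where
  root  : ∀ {α} → Node α
  under : ∀ {f} n → Node (f n) → Node (sup f)

infix 4 _<ᴺ_
data _<ᴺ_ : ∀ {α} → Node α → Node α → Set where
  <root  : ∀ {f n} {ν : Node (f n)} → under {f} n ν <ᴺ root
  <index : ∀ {f m n} {ν : Node (f m)} {μ : Node (f n)} → m ℕ.< n → under {f} m ν <ᴺ under n μ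
  <child : ∀ {f n} {ν μ : Node (f n)} → ν <ᴺ μ → under {f} n ν <ᴺ under n μ

<ᴺ-trans : ∀ {α} {ν μ ξ : Node α} → ν <ᴺ μ → μ <ᴺ ξ → ν <ᴺ ξ
<ᴺ-trans (<index _) <root = <root
<ᴺ-trans (<child _) <root = <root
<ᴺ-trans (<index p) (<index q) = <index (ℕₚ.<-trans p q)
<ᴺ-trans (<index p) (<child q) = <index p
<ᴺ-trans (<child p) (<index q) = <index q
<ᴺ-trans (<child p) (<child q) = <child (<ᴺ-trans p q)

<ᴺ-irrefl : ∀ {α} {ν : Node α} → ¬ (ν <ᴺ ν)
<ᴺ-irrefl (<index p) = ℕₚ.<-irrefl refl p
<ᴺ-irrefl (<child p) = <ᴺ-irrefl p

-- Exponents are nodes of a tree rather than trees because nodes are decidably linearly ordered, so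
-- ordinals can be compared without excluded middle.
compareᴺ : ∀ {α} (ν μ : Node α) → ν <ᴺ μ ⊎ ν ≡ μ ⊎ μ <ᴺ ν
compareᴺ root root = inj₂ (inj₁ refl)
compareᴺ root (under n μ) = inj₂ (inj₂ <root)
compareᴺ (under n ν) root = inj₁ <root
compareᴺ (under m ν) (under n μ) with ℕₚ.<-cmp m n
... | tri< p _ _ = inj₁ (<index p)
... | tri> _ _ p = inj₂ (inj₂ (<index p))
... | tri≈ _ refl _ with compareᴺ ν μ
...   | inj₁ p           = inj₁ (<child p)
...   | inj₂ (inj₁ refl) = inj₂ (inj₁ refl)
...   | inj₂ (inj₂ p)    = inj₂ (inj₂ (<child p))

module _ {f : ℕ → Ord} (wf : ∀ n → WellFounded (_<ᴺ_ {f n})) where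

  -- Lexicographic induction on the index of the subtree and the node inside it: predecessors of
  -- `under n ν` lie in subtrees of smaller index, or below `ν` in the same subtree.
  acc-under : ∀ {n} {ν : Node (f n)} → Acc ℕ._<_ n → Acc _<ᴺ_ ν → Acc _<ᴺ_ (under {f} n ν)
  acc-below : ∀ {n} {ν : Node (f n)} {μ} → Acc ℕ._<_ n → Acc _<ᴺ_ ν → μ <ᴺ under {f} n ν → Acc _<ᴺ_ μ

  acc-under p q = acc (acc-below p q)
  acc-below (acc rs) _ (<index p) = acc-under (rs p) (wf _ _)
  acc-below p (acc rs) (<child q) = acc-under p (rs q)

<ᴺ-wellFounded : ∀ {α} → WellFounded (_<ᴺ_ {α})
<ᴺ-wellFounded {leaf}  root = acc λ ()
<ᴺ-wellFounded {sup f} ν = acc-node ν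
  where
  below-root : ∀ n (ν : Node (f n)) → Acc _<ᴺ_ (under {f} n ν)
  below-root n ν = acc-under (λ n → <ᴺ-wellFounded {f n}) (ℕᵢ.<-wellFounded n) (<ᴺ-wellFounded ν)
  acc-node : (ν : Node (sup f)) → Acc _<ᴺ_ ν
  acc-node (under n ν) = below-root n ν
  acc-node root        = acc λ { <root → below-root _ _ }

-- This counts `n + 1` descents: one for each of the `n` vertices named by a word, and a last one
-- that makes the descent strict even for `n = 0`.
Steps : ∀ {α} → ℕ → Node α → Node α → Set
Steps zero    v w = v <ᴺ w
Steps (suc n) v w = ∃[ u ] u <ᴺ w × Steps n v u

Steps-raise : ∀ n {α} {v w w′ : Node α} → w <ᴺ w′ → Steps n v w → Steps n v w′
Steps-raise zero    p q           = <ᴺ-trans q p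
Steps-raise (suc n) p (u , q , s) = u , <ᴺ-trans q p , s

Steps⇒< : ∀ n {α} {v w : Node α} → Steps n v w → v <ᴺ w
Steps⇒< zero    p           = p
Steps⇒< (suc n) (u , p , s) = <ᴺ-trans (Steps⇒< n s) p

Monotone : ∀ {α β} → (Node α → Node β) → Set
Monotone h = ∀ {v w} → v <ᴺ w → h v <ᴺ h w

Steps-map : ∀ n {α β} {h : Node α → Node β} → Monotone h → ∀ {v w} → Steps n v w → Steps n (h v) (h w)
Steps-map zero    mono p           = mono p
Steps-map (suc n) mono (u , p , s) = _ , mono p , Steps-map n mono s

pad : ℕ → Ord → Ord
pad zero    α = α
pad (suc n) α = sup λ _ → pad n α

into : ∀ n {α} → Node α → Node (pad n α)
into zero    v = v
into (suc n) v = under 0 (into n v)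

into-mono : ∀ n {α} → Monotone (into n {α})
into-mono zero    p = p
into-mono (suc n) p = <child (into-mono n p)

Steps-pad : ∀ n {α β} {h : Node (pad n α) → Node β} → Monotone h → ∀ {w} → h root <ᴺ w → Steps n (h (into n root)) w
Steps-pad zero    mono p = p
Steps-pad (suc n) mono p = _ , p , Steps-pad n (mono ∘ <child) (mono <root)

-- A quantifier ranges over words naming any number of vertices, so `α` must be reachable after
-- arbitrarily many descents from one root.
room : Ord → Ord
room α = sup λ n → pad n α

rooms : ℕ → Ord
rooms zero    = leaf
rooms (suc k) = room (rooms k)

-- Numerical codes of nodes

pair : ℕ → ℕ → ℕ
pair m n = (m ℕ.+ n) ℕ.* (m ℕ.+ n) ℕ.+ m

-- With `s = m + n`, the codes for the sum `s` lie between `s²` and `s² + s`, which is less than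
-- `(s + 1)²`.
pair-sum-≮ : ∀ m n m′ n′ → pair m n ≡ pair m′ n′ → ¬ (m ℕ.+ n ℕ.< m′ ℕ.+ n′)
pair-sum-≮ m n m′ n′ e s<s′ = ℕₚ.<-irrefl e (begin-strict
  s ℕ.* s ℕ.+ m           ≤⟨ ℕₚ.+-monoʳ-≤ (s ℕ.* s) (ℕₚ.m≤m+n m n) ⟩
  s ℕ.* s ℕ.+ s           ≡⟨ ℕₚ.+-comm (s ℕ.* s) s ⟩
  suc s ℕ.* s           <⟨ ℕₚ.*-monoʳ-< (suc s) (ℕₚ.n<1+n s) ⟩
  suc s ℕ.* suc s       ≤⟨ ℕₚ.*-mono-≤ s<s′ s<s′ ⟩
  s′ ℕ.* s′             ≤⟨ ℕₚ.m≤m+n (s′ ℕ.* s′) m′ ⟩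
  s′ ℕ.* s′ ℕ.+ m′        ∎)
  where
  open ℕₚ.≤-Reasoning
  s = m ℕ.+ n
  s′ = m′ ℕ.+ n′

pair-injective : ∀ m n m′ n′ → pair m n ≡ pair m′ n′ → m ≡ m′ × n ≡ n′
pair-injective m n m′ n′ e with ℕₚ.<-cmp (m ℕ.+ n) (m′ ℕ.+ n′)
... | tri< p _ _ = ⊥-elim (pair-sum-≮ m n m′ n′ e p)
... | tri> _ _ p = ⊥-elim (pair-sum-≮ m′ n′ m n (sym e) p)
... | tri≈ _ s≡s′ _ = m≡m′ , ℕₚ.+-cancelˡ-≡ m n n′ (trans s≡s′ (cong (ℕ._+ n′) (sym m≡m′)))
  where
  m≡m′ : m ≡ m′
  m≡m′ = ℕₚ.+-cancelˡ-≡ ((m ℕ.+ n) ℕ.* (m ℕ.+ n)) m m′ (trans e (cong (λ s → s ℕ.* s ℕ.+ m′) (sym s≡s′)))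

codeᴺ : ∀ {α} → Node α → ℕ
codeᴺ root        = 0
codeᴺ (under n ν) = suc (pair n (codeᴺ ν))

codeᴺ-injective : ∀ {α} (ν μ : Node α) → codeᴺ ν ≡ codeᴺ μ → ν ≡ μ
codeᴺ-injective root root _ = refl
codeᴺ-injective (under m ν) (under n μ) e with pair-injective m (codeᴺ ν) n (codeᴺ μ) (ℕₚ.suc-injective e)
... | refl , e′ = cong (under m) (codeᴺ-injective ν μ e′)

-- Ordinals in Cantor normal form

module Normal (α : Ord) where

  W : Set
  W = Node α

  infix 4 _≤ᴺ_
  _≤ᴺ_ : W → W → Set
  u ≤ᴺ v = u <ᴺ v ⊎ u ≡ v

  <-≤ᴺ-trans : ∀ {u v w} → u <ᴺ v → v ≤ᴺ w → u <ᴺ w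
  <-≤ᴺ-trans p (inj₁ q)    = <ᴺ-trans p q
  <-≤ᴺ-trans p (inj₂ refl) = p

  ≤-<ᴺ-trans : ∀ {u v w} → u ≤ᴺ v → v <ᴺ w → u <ᴺ w
  ≤-<ᴺ-trans (inj₁ p) q    = <ᴺ-trans p q
  ≤-<ᴺ-trans (inj₂ refl) q = q

  ≤ᴺ-trans : ∀ {u v w} → u ≤ᴺ v → v ≤ᴺ w → u ≤ᴺ w
  ≤ᴺ-trans (inj₁ p) q    = inj₁ (<-≤ᴺ-trans p q)
  ≤ᴺ-trans (inj₂ refl) q = q

  <?≥ : ∀ u v → u <ᴺ v ⊎ v ≤ᴺ u
  <?≥ u v with compareᴺ u v
  ... | inj₁ p           = inj₁ p
  ... | inj₂ (inj₁ refl) = inj₂ (inj₂ refl)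
  ... | inj₂ (inj₂ p)    = inj₂ (inj₁ p)

  -- w₁ ∷ … ∷ wₖ with w₁ ≥ … ≥ wₖ stands for ω^w₁ + … + ω^wₖ.
  Pt : Set
  Pt = List W

  Normal : Pt → Set
  Normal = AllPairs (λ u v → v ≤ᴺ u)

  -- Diff x y d: x < y and x + d = y, where d is a suffix of y.
  data Diff : Pt → Pt → Pt → Set where
    nil  : ∀ {b y} → Diff [] (b ∷ y) (b ∷ y)
    head : ∀ {a b x y} → a <ᴺ b → Diff (a ∷ x) (b ∷ y) (b ∷ y)
    tail : ∀ {a x y d} → Diff x y d → Diff (a ∷ x) (a ∷ y) d

  infix 4 _<ᴾ_
  _<ᴾ_ : Pt → Pt → Set
  x <ᴾ y = ∃[ d ] Diff x y d

  compareᴾ : ∀ x y → x <ᴾ y ⊎ x ≡ y ⊎ y <ᴾ x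
  compareᴾ [] []      = inj₂ (inj₁ refl)
  compareᴾ [] (_ ∷ _) = inj₁ (_ , nil)
  compareᴾ (_ ∷ _) [] = inj₂ (inj₂ (_ , nil))
  compareᴾ (a ∷ x) (b ∷ y) with compareᴺ a b
  ... | inj₁ p        = inj₁ (_ , head p)
  ... | inj₂ (inj₂ p) = inj₂ (inj₂ (_ , head p))
  ... | inj₂ (inj₁ refl) with compareᴾ x y
  ...   | inj₁ (_ , p)        = inj₁ (_ , tail p)
  ...   | inj₂ (inj₁ refl)    = inj₂ (inj₁ refl)
  ...   | inj₂ (inj₂ (_ , p)) = inj₂ (inj₂ (_ , tail p))

  <ᴾ-irrefl : ∀ {x} → ¬ (x <ᴾ x)
  <ᴾ-irrefl (_ , head p) = <ᴺ-irrefl p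
  <ᴾ-irrefl (_ , tail p) = <ᴾ-irrefl (_ , p)

  <ᴾ-trans : ∀ {x y z} → x <ᴾ y → y <ᴾ z → x <ᴾ z
  <ᴾ-trans (_ , nil) (_ , head _) = _ , nil
  <ᴾ-trans (_ , nil) (_ , tail _) = _ , nil
  <ᴾ-trans (_ , head p) (_ , head q) = _ , head (<ᴺ-trans p q)
  <ᴾ-trans (_ , head p) (_ , tail _) = _ , head p
  <ᴾ-trans (_ , tail _) (_ , head q) = _ , head q
  <ᴾ-trans (_ , tail p) (_ , tail q) with <ᴾ-trans (_ , p) (_ , q)
  ... | _ , r = _ , tail r

  Diff-All : ∀ {P : W → Set} {x y d} → Diff x y d → All P y → All P d
  Diff-All nil      ps       = ps
  Diff-All (head _) ps       = ps
  Diff-All (tail p) (_ ∷ ps) = Diff-All p ps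

  Diff-Normal : ∀ {x y d} → Diff x y d → Normal y → Normal d
  Diff-Normal nil      n       = n
  Diff-Normal (head _) n       = n
  Diff-Normal (tail p) (_ ∷ n) = Diff-Normal p n

  Diff-nonempty : ∀ {x y d} → Diff x y d → ∃[ h ] ∃[ t ] d ≡ h ∷ t
  Diff-nonempty nil      = _ , _ , refl
  Diff-nonempty (head _) = _ , _ , refl
  Diff-nonempty (tail p) = Diff-nonempty p

  Diff-downward : ∀ {P : W → Set} → (∀ {u v} → u ≤ᴺ v → P v → P u) →
                  ∀ {x y d} → Diff x y d → Normal x → All P y → All P x
  Diff-downward dn nil      _       _        = []
  Diff-downward dn (head p) (q ∷ _) (Pb ∷ _) = dn (inj₁ p) Pb ∷ All.map (λ q → dn (inj₁ (≤-<ᴺ-trans q p)) Pb) q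
  Diff-downward dn (tail p) (_ ∷ n) (Pb ∷ P) = Pb ∷ Diff-downward dn p n P

  -- Left cancellation: `x₀ + D = x₁ = x₀ + d + r` gives `d + r = D`. Normality of `x` matters where
  -- `x₁` exceeds `x₀` at a letter which `x` shares with `x₀`: the letters of `d` are then no larger
  -- than that letter.
  Diff-sub : ∀ {x₀ x x₁ D d r} → Normal x → Diff x₀ x₁ D → Diff x₀ x d → Diff x x₁ r → Diff d D r
  Diff-sub n nil nil q = q
  Diff-sub n (head _) (head _) q = q
  Diff-sub n (head p) (tail r) (tail _) = ⊥-elim (<ᴺ-irrefl p)
  Diff-sub (n ∷ _) (head p) (tail r) (head _) with Diff-nonempty r | Diff-All r n
  ... | _ , _ , refl | q ∷ _ = head (≤-<ᴺ-trans q p)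
  Diff-sub n (tail p) (head r) (head q) = ⊥-elim (<ᴺ-irrefl (<ᴺ-trans r q))
  Diff-sub n (tail p) (head r) (tail q) = ⊥-elim (<ᴺ-irrefl r)
  Diff-sub n (tail p) (tail r) (head q) = ⊥-elim (<ᴺ-irrefl q)
  Diff-sub (_ ∷ n) (tail p) (tail r) (tail q) = Diff-sub n p r q

  -- add x h e is the normal form of x + (h ∷ e).
  add : Pt → W → Pt → Pt
  add [] h e = h ∷ e
  add (a ∷ x) h e with <?≥ a h
  ... | inj₁ _ = h ∷ e
  ... | inj₂ _ = a ∷ add x h e

  add-Diff : ∀ x h e → Diff x (add x h e) (h ∷ e)
  add-Diff [] h e = nil
  add-Diff (a ∷ x) h e with <?≥ a h
  ... | inj₁ p = head p
  ... | inj₂ _ = tail (add-Diff x h e)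

  add-All : ∀ {P : W → Set} x {h e} → All P x → All P (h ∷ e) → All P (add x h e)
  add-All [] _ ps = ps
  add-All (a ∷ x) {h} (q ∷ qs) ps with <?≥ a h
  ... | inj₁ _ = ps
  ... | inj₂ _ = q ∷ add-All x qs ps

  add-Normal : ∀ x {h e} → Normal x → Normal (h ∷ e) → Normal (add x h e)
  add-Normal [] _ n = n
  add-Normal (a ∷ x) {h} (q ∷ m) n with <?≥ a h
  ... | inj₁ _ = n
  ... | inj₂ h≤a with n
  ...   | r ∷ _ = add-All x q (h≤a ∷ All.map (λ s → ≤ᴺ-trans s h≤a) r) ∷ add-Normal x m n

  -- Associativity, the converse of `Diff-sub`. If `h` absorbed a letter `a` common to `y₀` and
  -- `y₁`, then `E` would start with a letter at least `h > a`, although normality of `y₁` bounds it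
  -- by `a`.
  add-Diffʳ : ∀ {y₀ y₁ E h e r} → Normal y₁ → Diff y₀ y₁ E → Diff (h ∷ e) E r → Diff (add y₀ h e) y₁ r
  add-Diffʳ n nil q = q
  add-Diffʳ {a ∷ _} {h = h} n (head p) q with <?≥ a h
  ... | inj₁ _ = q
  ... | inj₂ h≤a with q
  ...   | head _ = head p
  ...   | tail _ = ⊥-elim (<ᴺ-irrefl (<-≤ᴺ-trans p h≤a))
  add-Diffʳ {a ∷ _} {h = h} (n ∷ ns) (tail p) q with <?≥ a h
  ... | inj₂ _ = tail (add-Diffʳ ns p q)
  ... | inj₁ a<h with Diff-nonempty p | Diff-All p n
  ...   | b , _ , refl | b≤a ∷ _ with q
  ...     | head h<b = ⊥-elim (<ᴺ-irrefl (<ᴺ-trans a<h (<-≤ᴺ-trans h<b b≤a)))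
  ...     | tail _   = ⊥-elim (<ᴺ-irrefl (<-≤ᴺ-trans a<h b≤a))

  -- Gaps equivalent up to multiples of a power of ω

  -- Gap w d e: d and e agree up to non-zero multiples of ω^w.
  data Gap (w : W) : Pt → Pt → Set where
    same : ∀ {d} → Gap w d d
    far  : ∀ {b D c E} R → All (w ≤ᴺ_) (b ∷ D) → All (w ≤ᴺ_) (c ∷ E) →
           Gap w (b ∷ D ++ R) (c ∷ E ++ R)

  Gap-sym : ∀ {w d e} → Gap w d e → Gap w e d
  Gap-sym same        = same
  Gap-sym (far R p q) = far R q p

  Gap-weaken : ∀ {v w d e} → v ≤ᴺ w → Gap w d e → Gap v d e
  Gap-weaken v≤w same        = same
  Gap-weaken v≤w (far R p q) = far R (All.map (≤ᴺ-trans v≤w) p) (All.map (≤ᴺ-trans v≤w) q)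

  Diff-++ˡ : ∀ C {x y d} → Diff x y d → Diff (C ++ x) (C ++ y) d
  Diff-++ˡ []      p = p
  Diff-++ˡ (_ ∷ C) p = tail (Diff-++ˡ C p)

  Diff-++-split : ∀ D R {d r} → Diff d (D ++ R) r →
                  (∃[ s ] d ≡ D ++ s × Diff s R r) ⊎ (∃[ D″ ] Diff d D D″ × r ≡ D″ ++ R)
  Diff-++-split [] R p = inj₁ (_ , refl , p)
  Diff-++-split (b ∷ D) R nil      = inj₂ (_ , nil , refl)
  Diff-++-split (b ∷ D) R (head p) = inj₂ (_ , head p , refl)
  Diff-++-split (b ∷ D) R (tail p) with Diff-++-split D R p
  ... | inj₁ (s , refl , q)  = inj₁ (s , refl , q)
  ... | inj₂ (_ , q , refl)  = inj₂ (_ , tail q , refl)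

  Normal-++ˡ : ∀ D {R s r} → Normal (D ++ R) → Normal s → Diff s R r → Normal (D ++ s)
  Normal-++ˡ []      _       m _ = m
  Normal-++ˡ (b ∷ D) (q ∷ n) m p =
    Allₚ.++⁺ (Allₚ.++⁻ˡ D q) (Diff-downward ≤ᴺ-trans p m (Allₚ.++⁻ʳ D q)) ∷ Normal-++ˡ D n m p

  Normal-++⁻ʳ : ∀ D {s} → Normal (D ++ s) → Normal s
  Normal-++⁻ʳ []      n       = n
  Normal-++⁻ʳ (_ ∷ D) (_ ∷ n) = Normal-++⁻ʳ D n

  split : ∀ v d → Normal d → ∃[ D ] ∃[ R ] d ≡ D ++ R × All (v ≤ᴺ_) D × All (_<ᴺ v) R
  split v [] _ = [] , [] , refl , [] , []
  split v (a ∷ d) (q ∷ n) with <?≥ a v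
  ... | inj₁ a<v = [] , a ∷ d , refl , [] , a<v ∷ All.map (λ r → ≤-<ᴺ-trans r a<v) q
  ... | inj₂ v≤a with split v d n
  ...   | D , R , refl , p , r = a ∷ D , R , refl , v≤a ∷ p , r

  -- e replaces the multiple of ω^v in d by ω^v itself.
  truncate : ∀ {h t} v → Normal (h ∷ t) →
             ∃[ h′ ] ∃[ t′ ] Normal (h′ ∷ t′) × Gap v (h ∷ t) (h′ ∷ t′) × All (_≤ᴺ v) (h′ ∷ t′)
  truncate v n with split v _ n
  ... | [] , R , refl , _ , r = _ , _ , n , same , All.map inj₁ r
  ... | b ∷ D , R , refl , p , r =
    v , R , (All.map inj₁ r ∷ Normal-++⁻ʳ (b ∷ D) n) , far R p (inj₂ refl ∷ []) , inj₂ refl ∷ All.map inj₁ r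

  -- The single back-and-forth move: when a point splits the gap `D`, the equivalent gap `E` can be
  -- split so that both pieces match, at the cost of lowering `w` to `v`.
  place-below : ∀ {v w h t D E r} → v <ᴺ w → Normal (h ∷ t) → Normal E → Gap w D E → Diff (h ∷ t) D r →
                ∃[ h′ ] ∃[ t′ ] ∃[ r′ ] Normal (h′ ∷ t′) × Gap v (h ∷ t) (h′ ∷ t′) × Diff (h′ ∷ t′) E r′ × Gap v r r′
  place-below {v} v<w n m same p = _ , _ , _ , n , same , p , same
  place-below {v} v<w n m (far {b} {D} {c} {E} R gD gE@(w≤c ∷ _)) p with Diff-++-split (b ∷ D) R p
  -- The point lies beyond the multiple of `ω^w`: its part `s` inside the common remainder `R` is
  -- kept.
  ... | inj₁ (s , refl , q) =
        _ , _ , _ , Normal-++ˡ (c ∷ E) m (Normal-++⁻ʳ (b ∷ D) n) q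
      , Gap-weaken (inj₁ v<w) (far s gD gE) , Diff-++ˡ (c ∷ E) q , same
  -- The point lies inside the multiple of `ω^w`. Its truncation is below `ω^w` and is absorbed by
  -- the first letter of `E`, so all of `E` remains above it.
  ... | inj₂ (D″ , q , refl) with Diff-nonempty q | truncate v n
  ...   | _ , _ , refl | h′ , t′ , n′ , g , h′≤v ∷ _ =
        h′ , t′ , _ , n′ , g , head (<-≤ᴺ-trans (≤-<ᴺ-trans h′≤v v<w) w≤c)
      , Gap-weaken (inj₁ v<w) (far R (Diff-All q gD) gE)

  -- Well-foundedness of the ordinals

  _⊏_ : Pt → Pt → Set
  x ⊏ y = Normal x × x <ᴾ y

  <ᴾ-snoc : ∀ x {y d w} → Diff y (x ++ w ∷ []) d →
            y <ᴾ x ⊎ ∃[ z ] y ≡ x ++ z × (Normal z → All (_<ᴺ w) z)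
  <ᴾ-snoc [] nil      = inj₂ ([] , refl , λ _ → [])
  <ᴾ-snoc [] (head p) = inj₂ (_ , refl , λ { (q ∷ _) → p ∷ All.map (λ r → ≤-<ᴺ-trans r p) q })
  <ᴾ-snoc (a ∷ x) nil      = inj₁ (_ , nil)
  <ᴾ-snoc (a ∷ x) (head p) = inj₁ (_ , head p)
  <ᴾ-snoc (a ∷ x) (tail p) with <ᴾ-snoc x p
  ... | inj₁ (_ , q)        = inj₁ (_ , tail q)
  ... | inj₂ (z , refl , q) = inj₂ (z , refl , q)

  acc-++ : ∀ {P : W → Set} → (∀ {w} → P w → ∀ {x} → Acc _⊏_ x → Acc _⊏_ (x ++ w ∷ [])) →
           ∀ {z} → All P z → ∀ {x} → Acc _⊏_ x → Acc _⊏_ (x ++ z)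
  acc-++ snoc []             {x} a = subst (Acc _⊏_) (sym (++-identityʳ x)) a
  acc-++ snoc {w ∷ z} (p ∷ ps) {x} a = subst (Acc _⊏_) (++-assoc x (w ∷ []) z) (acc-++ snoc ps (snoc p a))

  -- A predecessor of `x + ω^w` either precedes `x` or is `x + z` with all exponents of `z` below
  -- `w`. The latter arises by finitely many additions of smaller powers, so induction on `w`
  -- applies.
  acc-snoc : ∀ {w} → Acc _<ᴺ_ w → ∀ {x} → Acc _⊏_ x → Acc _⊏_ (x ++ w ∷ [])
  acc-snoc {w} (acc rs) {x} (acc rs′) = acc λ where
    (n , _ , p) → case <ᴾ-snoc x p of λ where
      (inj₁ q)              → rs′ (n , q)
      (inj₂ (z , refl , q)) → acc-++ (λ r → acc-snoc (rs r)) (q (Normal-++⁻ʳ x n)) (acc rs′)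

  -- Restricting predecessors to normal lists is essential: on all lists, exponents `0 < 1` already
  -- give the descent `1 > 01 > 001 > …`.
  ⊏-wellFounded : WellFounded _⊏_
  ⊏-wellFounded x =
    acc-++ {P = λ _ → ⊤} (λ {w} _ → acc-snoc (<ᴺ-wellFounded w)) (All.universal _ x) (acc λ { (_ , _ , ()) })

  codeᴾ : Pt → ℕ
  codeᴾ []      = 0
  codeᴾ (a ∷ x) = suc (pair (codeᴺ a) (codeᴾ x))

  codeᴾ-injective : ∀ x y → codeᴾ x ≡ codeᴾ y → x ≡ y
  codeᴾ-injective [] [] _ = refl
  codeᴾ-injective (a ∷ x) (b ∷ y) e with pair-injective (codeᴺ a) (codeᴾ x) (codeᴺ b) (codeᴾ y) (ℕₚ.suc-injective e)
  ... | p , q = cong₂ _∷_ (codeᴺ-injective a b p) (codeᴾ-injective x y q)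

  -- Increasing chains of matched ordinals

  ≤root : ∀ w → w ≤ᴺ root
  ≤root root        = inj₂ refl
  ≤root (under _ _) = inj₁ <root

  -- true: the ordinals below ω^root; false: all ordinals in Pt.
  Valid : Bool → Pt → Set
  Valid b x = Normal x × (b ≡ true → All (_<ᴺ root) x)

  Pairs : Set
  Pairs = List (Pt × Pt)

  -- (x , y) ∷ ps is increasing in both components, with gaps matching up to multiples of ω^w.
  data Chain (b b′ : Bool) (w : W) : Pt → Pt → Pairs → Set where
    end  : ∀ {x y} → Chain b b′ w x y []
    link : ∀ {x y x′ y′ d e ps} → Diff x x′ d → Diff y y′ e → Gap w d e → Valid b x′ → Valid b′ y′ →
           Chain b b′ w x′ y′ ps → Chain b b′ w x y ((x′ , y′) ∷ ps)

  Chain-weaken : ∀ {b b′ v w x y ps} → v ≤ᴺ w → Chain b b′ w x y ps → Chain b b′ v x y ps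
  Chain-weaken v≤w end = end
  Chain-weaken v≤w (link p q g s t c) = link p q (Gap-weaken v≤w g) s t (Chain-weaken v≤w c)

  Chain-sym : ∀ {b b′ w x y ps} → Chain b b′ w x y ps → Chain b′ b w y x (map swap ps)
  Chain-sym end = end
  Chain-sym (link p q g s t c) = link q p (Gap-sym g) t s (Chain-sym c)

  Chain-valid : ∀ {b b′ w x y ps} → Valid b x → Valid b′ y → Chain b b′ w x y ps →
                ∀ {z z′} → (z , z′) ∈ (x , y) ∷ ps → Valid b z × Valid b′ z′
  Chain-valid s t c (here refl) = s , t
  Chain-valid _ _ (link _ _ _ s t c) (there i) = Chain-valid s t c i

  Chain-above : ∀ {b b′ w x y ps} → Chain b b′ w x y ps →
                ∀ {z z′} → (z , z′) ∈ ps → x <ᴾ z × y <ᴾ z′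
  Chain-above (link p q _ _ _ _) (here refl) = (_ , p) , (_ , q)
  Chain-above (link p q _ _ _ c) (there i) with Chain-above c i
  ... | r , s = <ᴾ-trans (_ , p) r , <ᴾ-trans (_ , q) s

  Chain-compare : ∀ {b b′ w x y ps} → Chain b b′ w x y ps →
                  ∀ {z z′ u u′} → (z , z′) ∈ (x , y) ∷ ps → (u , u′) ∈ (x , y) ∷ ps →
                  (z <ᴾ u × z′ <ᴾ u′) ⊎ (z ≡ u × z′ ≡ u′) ⊎ (u <ᴾ z × u′ <ᴾ z′)
  Chain-compare c (here refl) (here refl) = inj₂ (inj₁ (refl , refl))
  Chain-compare c (here refl) (there j)   = inj₁ (Chain-above c j)
  Chain-compare c (there i) (here refl)   = inj₂ (inj₂ (Chain-above c i))
  Chain-compare (link _ _ _ _ _ c) (there i) (there j) = Chain-compare c i j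

  -- The new ordinal `z` is followed along the chain until it passes the end, meets a link, or falls
  -- into a gap. In the first case a truncation of its distance from `x` is added to `y`; in the
  -- last, `place-below` splits the gap.
  Chain-insert : ∀ {b b′ v w x y ps z d} → v <ᴺ w → Valid b′ y → Chain b b′ w x y ps →
                 Valid b z → Diff x z d →
                 ∃[ z′ ] ∃[ qs ] Chain b b′ v x y qs × (z , z′) ∈ qs × (∀ {p} → p ∈ ps → p ∈ qs)
  Chain-insert {v = v} {w} {y = y} v<w (ny , by) end (nz , bz) r with Diff-nonempty r
  ... | _ , _ , refl with truncate v (Diff-Normal r nz)
  ...   | h , t , n , g , ≤v =
    add y h t , _
    , link r (add-Diff y h t) g (nz , bz)
        -- Truncated exponents are at most `v`, hence below the root, so the new ordinal stays below
        -- `ω^root` when `b′` is `true`.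
        (add-Normal y ny n , λ e → add-All y (by e) (All.map (λ u≤v → <-≤ᴺ-trans (≤-<ᴺ-trans u≤v v<w) (≤root w)) ≤v)) end
    , here refl , λ ()
  Chain-insert {y = y} {z = z} v<w (ny , by) (link {x′ = x′} p q g s (ny′ , by′) c) (nz , bz) r with compareᴾ z x′
  ... | inj₂ (inj₁ refl) =
    _ , _ , Chain-weaken (inj₁ v<w) (link p q g s (ny′ , by′) c) , here refl , λ i → i
  ... | inj₂ (inj₂ (_ , r′)) with Chain-insert v<w (ny′ , by′) c (nz , bz) r′
  ...   | z′ , qs , c′ , i , ⊆ =
    z′ , _ , link p q (Gap-weaken (inj₁ v<w) g) s (ny′ , by′) c′ , there i
    , λ { (here e) → here e ; (there j) → there (⊆ j) }
  Chain-insert {y = y} {z = z} v<w (ny , by) (link p q g s (ny′ , by′) c) (nz , bz) r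
      | inj₁ (_ , r′) with Diff-nonempty r
  ...   | _ , _ , refl with place-below v<w (Diff-Normal r nz) (Diff-Normal q ny′) g (Diff-sub nz p r r′)
  ...     | h , t , _ , n , g₁ , u , g₂ =
    add y h t , _
    , link r (add-Diff y h t) g₁ (nz , bz) (na , λ e → Diff-downward (λ u≤v v< → ≤-<ᴺ-trans u≤v v<) (add-Diffʳ ny′ q u) na (by′ e))
        (link r′ (add-Diffʳ ny′ q u) g₂ s (ny′ , by′) (Chain-weaken (inj₁ v<w) c))
    , here refl , there
    where na = add-Normal y ny n

-- Words and matched positions

-- Sim σ τ σ′ τ′: σ and τ first differ where σ′ and τ′ first differ, and in the same direction.
data Sim : List ℚ → List ℚ → List ℚ → List ℚ → Set where
  []   : Sim [] [] [] []
  less : ∀ {x y x′ y′ u v u′ v′} → x Q.< y → x′ Q.< y′ → Sim (x ∷ u) (y ∷ v) (x′ ∷ u′) (y′ ∷ v′)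
  more : ∀ {x y x′ y′ u v u′ v′} → y Q.< x → y′ Q.< x′ → Sim (x ∷ u) (y ∷ v) (x′ ∷ u′) (y′ ∷ v′)
  same : ∀ {x x′ u v u′ v′} → Sim u v u′ v′ → Sim (x ∷ u) (x ∷ v) (x′ ∷ u′) (x′ ∷ v′)

Sim-flip : ∀ {u v u′ v′} → Sim u v u′ v′ → Sim v u v′ u′
Sim-flip []         = []
Sim-flip (less p q) = more p q
Sim-flip (more p q) = less p q
Sim-flip (same s)   = same (Sim-flip s)

Sim-sym : ∀ {u v u′ v′} → Sim u v u′ v′ → Sim u′ v′ u v
Sim-sym []         = []
Sim-sym (less p q) = less q p
Sim-sym (more p q) = more q p
Sim-sym (same s)   = same (Sim-sym s)

Sim-≡ : ∀ {u v u′ v′} → Sim u v u′ v′ → u ≡ v → u′ ≡ v′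
Sim-≡ []         _    = refl
Sim-≡ (less p q) refl = ⊥-elim (Qₚ.<-irrefl refl p)
Sim-≡ (more p q) refl = ⊥-elim (Qₚ.<-irrefl refl p)
Sim-≡ (same s)   refl = cong (_ ∷_) (Sim-≡ s refl)

Sim-< : ∀ {u v u′ v′} → Sim u v u′ v′ → u <lex v → u′ <lex v′
Sim-< []         (base ())
Sim-< (less _ q) _             = this q
Sim-< (more p _) (this r)      = ⊥-elim (Qₚ.<-asym p r)
Sim-< (more p _) (next refl _) = ⊥-elim (Qₚ.<-irrefl refl p)
Sim-< (same _)   (this r)      = ⊥-elim (Qₚ.<-irrefl refl r)
Sim-< (same s)   (next _ r)    = next refl (Sim-< s r)

Sim-single : ∀ k l → Sim [ k ] [ l ] [ k ] [ l ]
Sim-single k l with Qₚ.<-cmp k l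
... | tri< p _ _    = less p p
... | tri≈ _ refl _ = same []
... | tri> _ _ p    = more p p

word : ∀ {n} → (Fin (suc n) → ℚ) → (Fin n → ℚ) → ℕ → List ℚ
word rs qs k = interleave rs qs ++ [ + k Q./ 1 ]

module Ordering (α : Ord) where

  open Normal α public

  𝔾 : Bool → Graph
  𝔾 b = record
    { V   = λ m → ∃[ x ] Valid b x × codeᴾ x ≡ m
    ; E   = λ m n → ∃[ x ] ∃[ y ] (Valid b x × codeᴾ x ≡ m) × (Valid b y × codeᴾ y ≡ n) × x <ᴾ y
    ; E⊆V = λ { (x , y , vx , vy , _) → (x , vx) , (y , vy) }
    }

  E⇒< : ∀ b {x y} → Graph.E (𝔾 b) (codeᴾ x) (codeᴾ y) → x <ᴾ y
  E⇒< b {x} {y} (x′ , y′ , (_ , e) , (_ , e′) , p)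
    with refl ← codeᴾ-injective x′ x e | refl ← codeᴾ-injective y′ y e′ = p

  <⇒E : ∀ {b x y} → Valid b x → Valid b y → x <ᴾ y → Graph.E (𝔾 b) (codeᴾ x) (codeᴾ y)
  <⇒E vx vy p = _ , _ , (vx , refl) , (vy , refl) , p

  data Match (ps : Pairs) : List ℚ → List ℚ → Set
  data Match′ (ps : Pairs) : List ℚ → List ℚ → Set

  data Match ps where
    stop : ∀ {r r′} → A 1 r → A 1 r′ → ∀ k → Match ps (r ∷ [ k ]) (r′ ∷ [ k ])
    more : ∀ {r r′ u u′} → A 0 r → A 0 r′ → Match′ ps u u′ → Match ps (r ∷ u) (r′ ∷ u′)

  data Match′ ps where
    elem : ∀ {x y q q′ u u′} → (x , y) ∈ ps → A (codeᴾ x) q → A (codeᴾ y) q′ →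
           Match ps u u′ → Match′ ps (q ∷ u) (q′ ∷ u′)

  Match-sym : ∀ {ps σ τ} → Match ps σ τ → Match (map swap ps) τ σ
  Match-sym (stop p q k)                  = stop q p k
  Match-sym (more p q (elem i r s m)) = more q p (elem (∈-map⁺ swap i) s r (Match-sym m))

  Match-Sim : ∀ {ps σ τ} → Match ps σ τ → Sim σ σ τ τ
  Match-Sim (stop _ _ _)              = same (same [])
  Match-Sim (more _ _ (elem _ _ _ m)) = same (same (Match-Sim m))

  Match-word : ∀ {ps n} {rs rs′ : Fin (suc n) → ℚ} {qs qs′ : Fin n → ℚ} {xs ys : Fin n → Pt} k →
               (∀ i → A 0 (rs (initial i))) → (∀ i → A 0 (rs′ (initial i))) →
               A 1 (last rs) → A 1 (last rs′) →
               (∀ i → A (codeᴾ (xs i)) (qs i)) → (∀ i → A (codeᴾ (ys i)) (qs′ i)) →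
               (∀ i → (xs i , ys i) ∈ ps) → Match ps (word rs qs k) (word rs′ qs′ k)
  Match-word {n = zero}  k _ _ l l′ _ _ _ = stop l l′ _
  Match-word {n = suc n} k a a′ l l′ c c′ i =
    more (a fzero) (a′ fzero) (elem (i fzero) (c fzero) (c′ fzero)
      (Match-word k (a ∘ fsuc) (a′ ∘ fsuc) l l′ (c ∘ fsuc) (c′ ∘ fsuc) (i ∘ fsuc)))

  -- Extending a match by one more word

  Cell : Set
  Cell = List ℚ × List ℚ × Pairs

  AllSim : List Cell → Set
  AllSim S = ∀ {σ τ ps σ′ τ′ ps′} → (σ , τ , ps) ∈ S → (σ′ , τ′ , ps′) ∈ S → Sim σ σ′ τ τ′

  Headed : Set
  Headed = ℚ × ℚ × Cell

  heads : List Cell → List Headed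
  heads []                               = []
  heads ((s ∷ u , s′ ∷ u′ , ps) ∷ S)     = (s , s′ , u , u′ , ps) ∷ heads S
  heads (([] , _ , _) ∷ S)               = heads S
  heads ((_ ∷ _ , [] , _) ∷ S)           = heads S

  ∈-heads⁺ : ∀ {S s s′ u u′ ps} → (s ∷ u , s′ ∷ u′ , ps) ∈ S → (s , s′ , u , u′ , ps) ∈ heads S
  ∈-heads⁺ (here refl) = here refl
  ∈-heads⁺ {(_ ∷ _ , _ ∷ _ , _) ∷ S} (there i) = there (∈-heads⁺ i)
  ∈-heads⁺ {([] , _ , _) ∷ S}        (there i) = ∈-heads⁺ i
  ∈-heads⁺ {(_ ∷ _ , [] , _) ∷ S}    (there i) = ∈-heads⁺ i

  ∈-heads⁻ : ∀ {S s s′ u u′ ps} → (s , s′ , u , u′ , ps) ∈ heads S → (s ∷ u , s′ ∷ u′ , ps) ∈ S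
  ∈-heads⁻ {(_ ∷ _ , _ ∷ _ , _) ∷ S} (here refl) = here refl
  ∈-heads⁻ {(_ ∷ _ , _ ∷ _ , _) ∷ S} (there i)   = there (∈-heads⁻ i)
  ∈-heads⁻ {([] , _ , _) ∷ S}        i           = there (∈-heads⁻ i)
  ∈-heads⁻ {(_ ∷ _ , [] , _) ∷ S}    i           = there (∈-heads⁻ i)

  tails : ℚ → List Cell → List Cell
  tails r S = map (proj₂ ∘ proj₂) (filter (λ c → proj₁ c Q.≟ r) (heads S))

  ∈-tails⁺ : ∀ {r S s′ u u′ ps} → (r ∷ u , s′ ∷ u′ , ps) ∈ S → (u , u′ , ps) ∈ tails r S
  ∈-tails⁺ {r} i = ∈-map⁺ (proj₂ ∘ proj₂) (∈-filter⁺ (λ c → proj₁ c Q.≟ r) (∈-heads⁺ i) refl)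

  ∈-tails⁻ : ∀ {r S u u′ ps} → (u , u′ , ps) ∈ tails r S → ∃[ s′ ] (r ∷ u , s′ ∷ u′ , ps) ∈ S
  ∈-tails⁻ {r} {S} i with ∈-map⁻ (proj₂ ∘ proj₂) i
  ... | (_ , s′ , _) , j , refl with ∈-filter⁻ (λ c → proj₁ c Q.≟ r) {xs = heads S} j
  ...   | k , refl = s′ , ∈-heads⁻ k

  Shared : ℚ → List Cell → Set
  Shared r S = ∃[ r′ ] ∃[ u ] ∃[ u′ ] ∃[ ps ] (r ∷ u , r′ ∷ u′ , ps) ∈ S

  Separated : ℚ → ℚ → List Cell → Set
  Separated r r′ S = ∀ {s s′ u u′ ps} → (s ∷ u , s′ ∷ u′ , ps) ∈ S → (r Q.< s × r′ Q.< s′) ⊎ (s Q.< r × s′ Q.< r′)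

  -- If `r` heads no word of `S`, then `AllSim` places the images of the smaller heads below those
  -- of the larger ones, and `A-between` fills this cut. The colour `m` is left open because a
  -- vertex letter gets its colour only after its vertex has been matched.
  shared-or-fresh : ∀ r S → AllSim S → Shared r S ⊎ (∀ m → ∃[ r′ ] A m r′ × Separated r r′ S)
  shared-or-fresh r S sim with any? (λ c → proj₁ c Q.≟ r) (heads S)
  ... | yes p with find p
  ...   | _ , i , refl = inj₁ (_ , _ , _ , _ , ∈-heads⁻ i)
  shared-or-fresh r S sim | no ¬p = inj₂ fresh
    where
    below above : List Headed
    below = filter (λ c → proj₁ c Qₚ.<? r) (heads S)
    above = filter (λ c → r Qₚ.<? proj₁ c) (heads S)
    ordered : ∀ {l u} → l ∈ map (proj₁ ∘ proj₂) below → u ∈ map (proj₁ ∘ proj₂) above → l Q.< u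
    ordered i j with ∈-map⁻ (proj₁ ∘ proj₂) i | ∈-map⁻ (proj₁ ∘ proj₂) j
    ... | _ , k , refl | _ , l , refl with ∈-filter⁻ (λ c → proj₁ c Qₚ.<? r) {xs = heads S} k | ∈-filter⁻ (λ c → r Qₚ.<? proj₁ c) {xs = heads S} l
    ...   | m , s<r | n , r<t with sim (∈-heads⁻ m) (∈-heads⁻ n)
    ...     | less _ p = p
    ...     | more p _ = ⊥-elim (Qₚ.<-asym p (Qₚ.<-trans s<r r<t))
    ...     | same _   = ⊥-elim (Qₚ.<-asym s<r r<t)
    fresh : ∀ m → ∃[ r′ ] A m r′ × Separated r r′ S
    fresh m with A-between m _ _ ordered
    ... | r′ , c , l< , <u = r′ , c , sep
      where
      sep : Separated r r′ S
      sep {s} i with Qₚ.<-cmp r s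
      ... | tri< p _ _    = inj₁ (p , <u (∈-map⁺ (proj₁ ∘ proj₂) (∈-filter⁺ (λ c → r Qₚ.<? proj₁ c) (∈-heads⁺ i) p)))
      ... | tri≈ _ refl _ = ⊥-elim (¬p (lose (∈-heads⁺ i) refl))
      ... | tri> _ _ p    = inj₂ (p , l< (∈-map⁺ (proj₁ ∘ proj₂) (∈-filter⁺ (λ c → proj₁ c Qₚ.<? r) (∈-heads⁺ i) p)))

  AllSim-tails : ∀ {r S} → AllSim S → AllSim (tails r S)
  AllSim-tails sim i j with ∈-tails⁻ i | ∈-tails⁻ j
  ... | _ , i′ | _ , j′ with sim i′ j′
  ... | less p _ = ⊥-elim (Qₚ.<-irrefl refl p)
  ... | more p _ = ⊥-elim (Qₚ.<-irrefl refl p)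
  ... | same s   = s

  shared-≡ : ∀ {r S s s′ u u′ v v′ ps qs} → AllSim S → (r ∷ u , s ∷ u′ , ps) ∈ S → (r ∷ v , s′ ∷ v′ , qs) ∈ S → s ≡ s′
  shared-≡ sim i j with sim i j
  ... | less p _ = ⊥-elim (Qₚ.<-irrefl refl p)
  ... | more p _ = ⊥-elim (Qₚ.<-irrefl refl p)
  ... | same _   = refl

  Sim-∷-shared : ∀ {r r′ S w w′ v v′ qs} → AllSim S → (r ∷ v , r′ ∷ v′ , qs) ∈ S →
                 (∀ {σ τ ps} → (σ , τ , ps) ∈ tails r S → Sim w σ w′ τ) →
                 ∀ {s s′ u u′ ps} → (s ∷ u , s′ ∷ u′ , ps) ∈ S → Sim (r ∷ w) (s ∷ u) (r′ ∷ w′) (s′ ∷ u′)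
  Sim-∷-shared sim i h j with sim i j
  ... | less p q = less p q
  ... | more p q = more p q
  ... | same _   = same (h (∈-tails⁺ j))

  Sim-∷-fresh : ∀ {r r′ S w w′} → Separated r r′ S →
                ∀ {s s′ u u′ ps} → (s ∷ u , s′ ∷ u′ , ps) ∈ S → Sim (r ∷ w) (s ∷ u) (r′ ∷ w′) (s′ ∷ u′)
  Sim-∷-fresh sep i with sep i
  ... | inj₁ (p , q) = less p q
  ... | inj₂ (p , q) = more p q

  -- Zero is always matched with zero: it is where chains start, so it is not among their links.
  from0 : Pairs → Pairs
  from0 ps = ([] , []) ∷ ps

  Valid-[] : ∀ b → Valid b []
  Valid-[] b = [] , λ _ → []

  module Extend (b b′ : Bool) where

    insert : ∀ {v w ps z} → v <ᴺ w → Chain b b′ w [] [] ps → Valid b z →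
             ∃[ z′ ] ∃[ qs ] Chain b b′ v [] [] qs × (z , z′) ∈ from0 qs × (∀ {p} → p ∈ from0 ps → p ∈ from0 qs)
    insert {z = []} p c _ = [] , _ , Chain-weaken (inj₁ p) c , here refl , λ i → i
    insert {z = _ ∷ _} p c vz with Chain-insert p (Valid-[] b′) c vz nil
    ... | z′ , qs , c′ , i , ⊆ = z′ , qs , c′ , there i , λ { (here e) → here e ; (there j) → there (⊆ j) }

    -- pre lists the pairs met on the common initial segment of all words in S.
    Good : W → Pairs → (Pairs → List ℚ → List ℚ → Set) → List Cell → Set
    Good w pre P S = ∀ {σ τ ps} → (σ , τ , ps) ∈ S →
      Chain b b′ w [] [] ps × (∀ {p} → p ∈ pre → p ∈ from0 ps) × P (from0 ps) σ τ

    -- The images of the remaining letters of a word p ++ word rs qs k whose letters p have image p′.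
    record Image (v : W) (pre : Pairs) (S : List Cell) (p p′ : List ℚ) {n}
                 (rs : Fin (suc n) → ℚ) (qs : Fin n → ℚ) (xs : Fin n → Pt) (k : ℕ) : Set where
      field
        rs′   : Fin (suc n) → ℚ
        qs′   : Fin n → ℚ
        ys    : Fin n → Pt
        ps    : Pairs
        chain : Chain b b′ v [] [] ps
        pre⊆  : ∀ {z} → z ∈ pre → z ∈ from0 ps
        pairs : ∀ i → (xs i , ys i) ∈ from0 ps
        inner : ∀ i → A 0 (rs′ (initial i))
        final : A 1 (last rs′)
        elems : ∀ i → A (codeᴾ (ys i)) (qs′ i)
        sim   : ∀ {σ τ ps} → (σ , τ , ps) ∈ S → Sim (p ++ word rs qs k) σ (p′ ++ word rs′ qs′ k) τ

    Image-shared : ∀ {v pre S r r′ u u′ ps p p′ n} {rs : Fin (suc n) → ℚ} {qs xs k} →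
                   (∀ {σ τ ps} → (σ , τ , ps) ∈ S → ∃[ s ] ∃[ u ] ∃[ s′ ] ∃[ u′ ] σ ≡ s ∷ u × τ ≡ s′ ∷ u′) →
                   AllSim S → (r ∷ u , r′ ∷ u′ , ps) ∈ S →
                   Image v pre (tails r S) p p′ rs qs xs k → Image v pre S (r ∷ p) (r′ ∷ p′) rs qs xs k
    Image-shared ne all i im = record
      { Image im ; sim = λ j → case ne j of λ { (_ , _ , _ , _ , refl , refl) → Sim-∷-shared all i (Image.sim im) j } }

    Image-fresh : ∀ {v pre S r r′ p p′ n} {rs : Fin (suc n) → ℚ} {qs xs k} →
                  (∀ {σ τ ps} → (σ , τ , ps) ∈ S → ∃[ s ] ∃[ u ] ∃[ s′ ] ∃[ u′ ] σ ≡ s ∷ u × τ ≡ s′ ∷ u′) →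
                  Separated r r′ S →
                  Image v pre [] p p′ rs qs xs k → Image v pre S (r ∷ p) (r′ ∷ p′) rs qs xs k
    Image-fresh ne sep im = record
      { Image im ; sim = λ j → case ne j of λ { (_ , _ , _ , _ , refl , refl) → Sim-∷-fresh sep j } }

    Match-nonempty : ∀ {ps σ τ} → Match ps σ τ → ∃[ s ] ∃[ u ] ∃[ s′ ] ∃[ u′ ] σ ≡ s ∷ u × τ ≡ s′ ∷ u′
    Match-nonempty (stop _ _ _) = _ , _ , _ , _ , refl , refl
    Match-nonempty (more _ _ _) = _ , _ , _ , _ , refl , refl

    Match′-nonempty : ∀ {ps σ τ} → Match′ ps σ τ → ∃[ s ] ∃[ u ] ∃[ s′ ] ∃[ u′ ] σ ≡ s ∷ u × τ ≡ s′ ∷ u′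
    Match′-nonempty (elem _ _ _ _) = _ , _ , _ , _ , refl , refl

    -- The new word is followed letter by letter. As long as its letters are shared with words of
    -- `S`, their images are forced; at the first unshared letter an image in the same cut is
    -- chosen, and later letters need no comparison with `S`.
    image : ∀ n {v w pre ps S} {rs : Fin (suc n) → ℚ} {qs : Fin n → ℚ} {xs : Fin n → Pt} k →
            Steps n v w → Chain b b′ w [] [] ps → (∀ {z} → z ∈ pre → z ∈ from0 ps) →
            Good w pre Match S → AllSim S →
            (∀ i → A 0 (rs (initial i))) → A 1 (last rs) →
            (∀ i → Valid b (xs i)) → (∀ i → A (codeᴾ (xs i)) (qs i)) →
            Image v pre S [] [] rs qs xs k

    image′ : ∀ n {v w pre ps S} {rs : Fin (suc n) → ℚ} {qs : Fin (suc n) → ℚ} {xs : Fin (suc n) → Pt} k →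
             Steps (suc n) v w → Chain b b′ w [] [] ps → (∀ {z} → z ∈ pre → z ∈ from0 ps) →
             Good w pre Match′ S → AllSim S →
             (∀ i → A 0 (rs (initial i))) → A 1 (last rs) →
             (∀ i → Valid b (xs i)) → (∀ i → A (codeᴾ (xs i)) (qs i)) →
             ∃[ q′ ] ∃[ y ] A (codeᴾ y) q′ ×
               Image v ((xs fzero , y) ∷ pre) S (qs fzero ∷ []) (q′ ∷ []) rs (qs ∘ fsuc) (xs ∘ fsuc) k

    image zero {S = S} {rs} k st ch pre⊆ good all a0 a1 vx ax with shared-or-fresh (rs fzero) S all
    ... | inj₁ (r′ , u , u′ , ps , i) with good i
    ...   | _ , _ , more a _ _ = ⊥-elim (A₀₁-disjoint {rs fzero} a a1)
    ...   | _ , _ , stop _ a1′ _ = record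
      { rs′ = λ _ → r′ ; qs′ = λ () ; ys = λ () ; chain = Chain-weaken (inj₁ st) ch ; pre⊆ = pre⊆
      ; pairs = λ () ; inner = λ () ; final = a1′ ; elems = λ ()
      ; sim = λ j → case Match-nonempty (proj₂ (proj₂ (good j))) of λ where
          (_ , _ , _ , _ , refl , refl) → Sim-∷-shared all i tail-sim j }
      where
      tail-sim : ∀ {σ τ qs} → (σ , τ , qs) ∈ tails (rs fzero) S → Sim [ + k Q./ 1 ] σ [ + k Q./ 1 ] τ
      tail-sim m with ∈-tails⁻ m
      ... | _ , m′ with good m′
      ... | _ , _ , stop _ _ l   = Sim-single _ _
      ... | _ , _ , more a _ _ = ⊥-elim (A₀₁-disjoint {rs fzero} a a1)
    image zero {S = S} {rs} k st ch pre⊆ good all a0 a1 vx ax | inj₂ fresh with fresh 1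
    ... | r′ , a1′ , sep = record
      { rs′ = λ _ → r′ ; qs′ = λ () ; ys = λ () ; chain = Chain-weaken (inj₁ st) ch ; pre⊆ = pre⊆
      ; pairs = λ () ; inner = λ () ; final = a1′ ; elems = λ ()
      ; sim = λ j → case Match-nonempty (proj₂ (proj₂ (good j))) of λ where
          (_ , _ , _ , _ , refl , refl) → Sim-∷-fresh sep j }
    image (suc n) {v} {w} {pre} {S = S} {rs} {qs} {xs} k st ch pre⊆ good all a0 a1 vx ax =
      case shared-or-fresh (rs fzero) S all of λ where
        (inj₁ (r′ , _ , _ , _ , i)) → case proj₂ (proj₂ (good i)) of λ where
          (stop a _ _)  → ⊥-elim (A₀₁-disjoint {rs fzero} (a0 fzero) a)
          (more _ a0′ _) → let q′ , y , ay , im = image′ n {qs = qs} k st ch pre⊆ (good-tails good) (AllSim-tails all)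
                                                      (a0 ∘ fsuc) a1 vx ax
                           in assemble a0′ ay (Image-shared nonempty all i im)
        -- This letter decides all comparisons, so the recursion continues with the empty list of
        -- words.
        (inj₂ fresh) → let r′ , a0′ , sep = fresh 0
                           q′ , y , ay , im = image′ n {qs = qs} k st ch pre⊆ (λ ()) (λ ()) (a0 ∘ fsuc) a1 vx ax
                       in assemble a0′ ay (Image-fresh nonempty sep im)
      where
      nonempty : ∀ {σ τ ps} → (σ , τ , ps) ∈ S → ∃[ s ] ∃[ u ] ∃[ s′ ] ∃[ u′ ] σ ≡ s ∷ u × τ ≡ s′ ∷ u′
      nonempty j = Match-nonempty (proj₂ (proj₂ (good j)))
      good-tails : Good w pre Match S → Good w pre Match′ (tails (rs fzero) S)
      good-tails g j with ∈-tails⁻ j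
      ... | _ , j′ with g j′
      ... | c , ⊆ , more _ _ m = c , ⊆ , m
      ... | _ , _ , stop a _ _ = ⊥-elim (A₀₁-disjoint {rs fzero} (a0 fzero) a)
      assemble : ∀ {r′ q′ y} → A 0 r′ → A (codeᴾ y) q′ →
                 Image v ((xs fzero , y) ∷ pre) S (rs fzero ∷ qs fzero ∷ []) (r′ ∷ q′ ∷ []) (rs ∘ fsuc) (qs ∘ fsuc) (xs ∘ fsuc) k →
                 Image v pre S [] [] rs qs xs k
      assemble {r′} {q′} {y} a ay im = record
        { rs′ = r′ ◂ I.rs′ ; qs′ = q′ ◂ I.qs′ ; ys = y ◂ I.ys ; ps = I.ps ; chain = I.chain
        ; pre⊆  = I.pre⊆ ∘ there
        ; pairs = λ { fzero → I.pre⊆ (here refl) ; (fsuc i) → I.pairs i }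
        ; inner = λ { fzero → a ; (fsuc i) → I.inner i }
        ; final = I.final
        ; elems = λ { fzero → ay ; (fsuc i) → I.elems i }
        ; sim   = I.sim }
        where module I = Image im

    image′ n {S = S} {qs = qs} {xs} k st ch pre⊆ good all a0 a1 vx ax with shared-or-fresh (qs fzero) S all
    image′ n {v} {w} {pre} {S = S} {qs = qs} {xs} k (_ , u<w , st) ch pre⊆ good all a0 a1 vx ax
      | inj₁ (q′ , _ , _ , ps , i) with good i
    -- The colour of the shared letter determines its vertex, so the vertex already has a partner
    -- `y`.
    ... | c , ⊆ , elem {x} {y} j ax₀ ay _ with codeᴾ-injective x (xs fzero) (A-unique {q = qs fzero} ax₀ (ax fzero))
    ...   | refl = q′ , y , ay ,
        -- Nothing is inserted, so `Steps-raise` gives the descent back. The chain of the word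
        -- sharing the letter takes over; it contains every pair met so far.
        Image-shared nonempty all i (image n k (Steps-raise n u<w st) c
          (λ { (here refl) → j ; (there z) → ⊆ z }) good-tails (AllSim-tails all) a0 a1 (vx ∘ fsuc) (ax ∘ fsuc))
      where
      nonempty : ∀ {σ τ ps} → (σ , τ , ps) ∈ S → ∃[ s ] ∃[ u ] ∃[ s′ ] ∃[ u′ ] σ ≡ s ∷ u × τ ≡ s′ ∷ u′
      nonempty j = Match′-nonempty (proj₂ (proj₂ (good j)))
      good-tails : Good w ((xs fzero , y) ∷ pre) Match (tails (qs fzero) S)
      good-tails m with ∈-tails⁻ m
      ... | s′ , l with shared-≡ all i l | good l
      ...   | refl | c′ , ⊆′ , elem {x′} {y′} j′ ax′ ay′ m′
        with refl ← codeᴾ-injective x′ (xs fzero) (A-unique {q = qs fzero} ax′ (ax fzero))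
           | refl ← codeᴾ-injective y′ y (A-unique {q = q′} ay′ ay) =
        c′ , (λ { (here refl) → j′ ; (there z) → ⊆′ z }) , m′
    image′ n {S = S} {qs = qs} {xs} k (_ , u<w , st) ch pre⊆ good all a0 a1 vx ax | inj₂ fresh
      with insert u<w ch (vx fzero)
    ... | y , ps , c , j , ⊆ with fresh (codeᴾ y)
    ...   | q′ , ay , sep = q′ , y , ay ,
        Image-fresh (λ j → Match′-nonempty (proj₂ (proj₂ (good j)))) sep (image n k st c
          (λ { (here refl) → j ; (there z) → ⊆ (pre⊆ z) }) (λ ()) (λ ()) a0 a1 (vx ∘ fsuc) (ax ∘ fsuc))

-- Ranks of formulas

-- φ can be evaluated with the quantifier moves available from rank w.
Fits : ∀ {α n} → Formula n → Node α → Set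
Fits tt       w = ⊤
Fits (i ≐ j)  w = ⊤
Fits (i ≺' j) w = ⊤
Fits (¬' φ)   w = Fits φ w
Fits (⋀ φs)   w = ∀ i → Fits (φs i) w
Fits (⋁ φs)   w = ∀ i → Fits (φs i) w
Fits (∀' φ)   w = ∀ n → ∃[ v ] Steps n v w × Fits φ v
Fits (∃' φ)   w = ∀ n → ∃[ v ] Steps n v w × Fits φ v

Fits-raise : ∀ {n} (φ : Formula n) {α} {v w : Node α} → v <ᴺ w → Fits φ v → Fits φ w
Fits-raise tt       p f = f
Fits-raise (i ≐ j)  p f = f
Fits-raise (i ≺' j) p f = f
Fits-raise (¬' φ)   p f = Fits-raise φ p f
Fits-raise (⋀ φs)   p f i = Fits-raise (φs i) p (f i)
Fits-raise (⋁ φs)   p f i = Fits-raise (φs i) p (f i)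
Fits-raise (∀' φ)   p f n = let v , s , g = f n in v , Steps-raise n p s , g
Fits-raise (∃' φ)   p f n = let v , s , g = f n in v , Steps-raise n p s , g

Fits-map : ∀ {n} (φ : Formula n) {α β} {h : Node α → Node β} → Monotone h → ∀ {w} → Fits φ w → Fits φ (h w)
Fits-map tt       mono f = f
Fits-map (i ≐ j)  mono f = f
Fits-map (i ≺' j) mono f = f
Fits-map (¬' φ)   mono f = Fits-map φ mono f
Fits-map (⋀ φs)   mono f i = Fits-map (φs i) mono (f i)
Fits-map (⋁ φs)   mono f i = Fits-map (φs i) mono (f i)
Fits-map (∀' φ)   mono f n = let v , s , g = f n in _ , Steps-map n mono s , Fits-map φ mono g
Fits-map (∃' φ)   mono f n = let v , s , g = f n in _ , Steps-map n mono s , Fits-map φ mono g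

-- Quantifiers call for descents; negation costs nothing because matching is symmetric.
rank : ∀ {n} → Formula n → Ord
rank tt       = leaf
rank (i ≐ j)  = leaf
rank (i ≺' j) = leaf
rank (¬' φ)   = rank φ
rank (⋀ φs)   = sup λ i → rank (φs i)
rank (⋁ φs)   = sup λ i → rank (φs i)
rank (∀' φ)   = room (rank φ)
rank (∃' φ)   = room (rank φ)

Fits-sup : ∀ {n} (φ : Formula n) {f} i → Fits φ (root {f i}) → Fits φ (root {sup f})
Fits-sup φ i p = Fits-raise φ <root (Fits-map φ {h = under i} <child p)

Fits-rank : ∀ {n} (φ : Formula n) → Fits φ (root {rank φ})
Fits-rank tt       = _
Fits-rank (i ≐ j)  = _
Fits-rank (i ≺' j) = _
Fits-rank (¬' φ)   = Fits-rank φ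
Fits-rank (⋀ φs) i = Fits-sup (φs i) i (Fits-rank (φs i))
Fits-rank (⋁ φs) i = Fits-sup (φs i) i (Fits-rank (φs i))
Fits-rank (∀' φ) n = _ , Steps-pad n <child <root , Fits-map φ (<child ∘ into-mono n) (Fits-rank φ)
Fits-rank (∃' φ) n = _ , Steps-pad n <child <root , Fits-map φ (<child ∘ into-mono n) (Fits-rank φ)

-- Room w₀ k w: k further elements can be matched from rank w while staying above w₀.
Room : ∀ {α} → Node α → ℕ → Node α → Set
Room w₀ zero    w = w₀ <ᴺ w
Room w₀ (suc k) w = ∀ n → ∃[ v ] Steps n v w × Room w₀ k v

Room-rooms : ∀ k {α} {w₀ : Node α} {h : Node (rooms k) → Node α} → Monotone h → (∀ v → w₀ <ᴺ h v) → Room w₀ k (h root)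
Room-rooms zero    mono w₀< = w₀< root
Room-rooms (suc k) mono w₀< n =
  _ , Steps-pad n (mono ∘ <child) (mono <root) , Room-rooms k (mono ∘ <child ∘ into-mono n) (λ v → w₀< _)

-- The back-and-forth system between the two orderings

module Games (α : Ord) where

  open Ordering α public

  𝕃 : Bool → OrdStr
  𝕃 b = L (𝔾 b)

  El : Bool → Set
  El b = OrdStr.Carrier (𝕃 b)

  height : ∀ {b} → El b → ℕ
  height (_ , n , _) = n

  -- Each matched pair of words has a chain of its own. Different words are related only through
  -- `sims`, which is why `≈-++` can join two matches once their cross comparisons agree.
  record _≈[_]_ {b b′ n} (ρ : Fin n → El b) (w : W) (ρ′ : Fin n → El b′) : Set where
    field
      matches : ∀ i → ∃[ ps ] Chain b b′ w [] [] ps × Match (from0 ps) (proj₁ (ρ i)) (proj₁ (ρ′ i))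
      sims    : ∀ i j → Sim (proj₁ (ρ i)) (proj₁ (ρ j)) (proj₁ (ρ′ i)) (proj₁ (ρ′ j))

  open _≈[_]_ public

  ≈-sym : ∀ {b b′ n w} {ρ : Fin n → El b} {ρ′ : Fin n → El b′} → ρ ≈[ w ] ρ′ → ρ′ ≈[ w ] ρ
  ≈-sym I = record
    { matches = λ i → let ps , c , m = matches I i in map swap ps , Chain-sym c , Match-sym m
    ; sims    = λ i j → Sim-sym (sims I i j) }

  ≈-lower : ∀ {b b′ n v w} {ρ : Fin n → El b} {ρ′ : Fin n → El b′} → v ≤ᴺ w → ρ ≈[ w ] ρ′ → ρ ≈[ v ] ρ′
  ≈-lower v≤w I = record
    { matches = λ i → let ps , c , m = matches I i in ps , Chain-weaken v≤w c , m
    ; sims    = sims I }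

  ≈-extend : ∀ {b b′ n v w} {ρ : Fin n → El b} {ρ′ : Fin n → El b′} → ρ ≈[ w ] ρ′ →
             (x : El b) → Steps (height x) v w → ∃[ y ] extend x ρ ≈[ v ] extend {El b′} y ρ′
  ≈-extend {b} {b′} {N} {v} {w} {ρ} {ρ′} I
    (_ , n , rs , qs , as , m , k , refl , a0 , a1 , inj , inV , aq , 1≤m , (j , j< , m≡ , bits) , k<m) st =
    y , record { matches = matches′ ; sims = sims′ }
    where
    open Extend b b′
    xs : Fin n → Pt
    xs i = proj₁ (inV i)
    vx : ∀ i → Valid b (xs i)
    vx i = proj₁ (proj₂ (inV i))
    as≡ : ∀ i → codeᴾ (xs i) ≡ as i
    as≡ i = proj₂ (proj₂ (inV i))
    S : List Cell
    S = tabulate (λ i → proj₁ (ρ i) , proj₁ (ρ′ i) , proj₁ (matches I i))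
    good : Good w [] Match S
    good i with ∈-tabulate⁻ i
    ... | i , refl = proj₁ (proj₂ (matches I i)) , (λ ()) , proj₂ (proj₂ (matches I i))
    all : AllSim S
    all i j with ∈-tabulate⁻ i | ∈-tabulate⁻ j
    ... | i , refl | j , refl = sims I i j
    aq′ : ∀ i → A (codeᴾ (xs i)) (qs i)
    aq′ i = subst (λ a → A a (qs i)) (sym (as≡ i)) (aq i)
    im : Image v [] S [] [] rs qs xs k
    im = image n k st (end {x = []} {y = []}) (λ ()) good all a0 a1 vx aq′
    open Image im
    valid : ∀ i → Valid b (xs i) × Valid b′ (ys i)
    valid i = Chain-valid (Valid-[] b) (Valid-[] b′) chain (pairs i)
    ys-inj : ∀ i j → codeᴾ (ys i) ≡ codeᴾ (ys j) → i ≡ j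
    ys-inj i j e with codeᴾ-injective (ys i) (ys j) e | Chain-compare chain (pairs i) (pairs j)
    ... | e′ | inj₁ (_ , p) = ⊥-elim (<ᴾ-irrefl (subst (_<ᴾ ys j) e′ p))
    ... | e′ | inj₂ (inj₂ (_ , p)) = ⊥-elim (<ᴾ-irrefl (subst (ys j <ᴾ_) e′ p))
    ... | e′ | inj₂ (inj₁ (p , _)) = inj i j (trans (sym (as≡ i)) (trans (cong codeᴾ p) (as≡ j)))
    edge⇒ : ∀ i j → Graph.E (𝔾 b′) (codeᴾ (ys i)) (codeᴾ (ys j)) → Graph.E (𝔾 b) (as i) (as j)
    edge⇒ i j e rewrite sym (as≡ i) | sym (as≡ j) = <⇒E (vx i) (vx j) (xs< (E⇒< b′ e))
      where
      xs< : ys i <ᴾ ys j → xs i <ᴾ xs j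
      xs< q with Chain-compare chain (pairs i) (pairs j)
      ... | inj₁ (p , _) = p
      ... | inj₂ (inj₁ (_ , p)) = ⊥-elim (<ᴾ-irrefl (subst (_<ᴾ ys j) p q))
      ... | inj₂ (inj₂ (_ , p)) = ⊥-elim (<ᴾ-irrefl (<ᴾ-trans p q))
    edge⇐ : ∀ i j → Graph.E (𝔾 b) (as i) (as j) → Graph.E (𝔾 b′) (codeᴾ (ys i)) (codeᴾ (ys j))
    edge⇐ i j e rewrite sym (as≡ i) | sym (as≡ j) = <⇒E (proj₂ (valid i)) (proj₂ (valid j)) (ys< (E⇒< b e))
      where
      ys< : xs i <ᴾ xs j → ys i <ᴾ ys j
      ys< q with Chain-compare chain (pairs i) (pairs j)
      ... | inj₁ (_ , p) = p
      ... | inj₂ (inj₁ (p , _)) = ⊥-elim (<ᴾ-irrefl (subst (_<ᴾ xs j) p q))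
      ... | inj₂ (inj₂ (p , _)) = ⊥-elim (<ᴾ-irrefl (<ᴾ-trans p q))
    -- The chain orders `ys` as it orders `xs`, so the type `m` and the number `k` carry over.
    y : El b′
    y = word rs′ qs′ k , n , rs′ , qs′ , codeᴾ ∘ ys , m , k , refl , inner , final , ys-inj
      , (λ i → ys i , proj₂ (valid i) , refl) , elems , 1≤m
      , (j , j< , m≡ , λ i k → mk⇔ (Equivalence.to (bits i k) ∘ edge⇒ i k) (edge⇐ i k ∘ Equivalence.from (bits i k)))
      , k<m
    v<w : v <ᴺ w
    v<w = Steps⇒< n st
    new : Match (from0 ps) (word rs qs k) (word rs′ qs′ k)
    new = Match-word {rs = rs} {rs′} {qs} {qs′} {xs} {ys} k a0 inner a1 final aq′ elems pairs
    matches′ : ∀ i → ∃[ ps ] Chain b b′ v [] [] ps × Match (from0 ps) (proj₁ (extend _ ρ i)) (proj₁ (extend y ρ′ i))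
    matches′ fzero    = ps , chain , new
    matches′ (fsuc i) = let ps , c , m = matches I i in ps , Chain-weaken (inj₁ v<w) c , m
    sims′ : ∀ i j → Sim (proj₁ (extend _ ρ i)) (proj₁ (extend _ ρ j)) (proj₁ (extend y ρ′ i)) (proj₁ (extend y ρ′ j))
    sims′ fzero    fzero    = Match-Sim new
    sims′ fzero    (fsuc j) = sim (∈-tabulate⁺ j)
    sims′ (fsuc i) fzero    = Sim-flip (sim (∈-tabulate⁺ i))
    sims′ (fsuc i) (fsuc j) = sims I i j

  -- Karp's induction on `φ`. At a quantifier, the number of vertices named by the chosen word says
  -- how many descents to take.
  transfer : ∀ {n} (φ : Formula n) {w b b′} {ρ : Fin n → El b} {ρ′ : Fin n → El b′} →
             Fits φ w → ρ ≈[ w ] ρ′ → Sat (𝕃 b) φ ρ → Sat (𝕃 b′) φ ρ′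
  transfer tt       f I s = s
  transfer (i ≐ j)  f I s = Sim-≡ (sims I i j) s
  transfer (i ≺' j) f I s = Sim-< (sims I i j) s
  transfer (¬' φ)   f I s s′ = s (transfer φ f (≈-sym I) s′)
  transfer (⋀ φs)   f I s i = transfer (φs i) (f i) I (s i)
  transfer (⋁ φs)   f I (i , s) = i , transfer (φs i) (f i) I s
  transfer (∀' φ)   f I s y =
    let v , st , g = f (height y)
        x , J      = ≈-extend (≈-sym I) y st
    in transfer φ g (≈-sym J) (s x)
  transfer (∃' φ)   f I (x , s) =
    let v , st , g = f (height x)
        y , J      = ≈-extend I x st
    in y , transfer φ g J s

  -- The match starts empty and grows from the last entry of the tuple to the first; `j` counts the
  -- moves kept for later.
  copy : ∀ k j {w₀ w b b′} → Room w₀ (k ℕ.+ j) w → (ρ : Fin k → El b) →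
         ∃[ v ] Room w₀ j v × Σ (Fin k → El b′) λ ρ′ → ρ ≈[ v ] ρ′
  copy zero    j r ρ = _ , r , (λ ()) , record { matches = λ () ; sims = λ () }
  copy (suc k) j {w₀} {w} r ρ with copy k (suc j) (subst (λ n → Room w₀ n w) (sym (ℕₚ.+-suc k j)) r) (ρ ∘ fsuc)
  ... | v , r′ , ρ′ , I with r′ (height (ρ fzero))
  ...   | u , st , r″ with ≈-extend I (ρ fzero) st
  ...     | y , J = u , r″ , extend y ρ′ , record
    -- `extend (ρ fzero) (ρ ∘ fsuc)` agrees with `ρ` only pointwise, hence the case distinction.
    { matches = λ { fzero → matches J fzero ; (fsuc i) → matches J (fsuc i) }
    ; sims = λ { fzero fzero → sims J fzero fzero ; fzero (fsuc j) → sims J fzero (fsuc j)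
               ; (fsuc i) fzero → sims J (fsuc i) fzero ; (fsuc i) (fsuc j) → sims J (fsuc i) (fsuc j) } }

  ≈-++ : ∀ {b b′ n m w} {ρ : Fin n → El b} {ρ′ : Fin n → El b′} {τ : Fin m → El b} {τ′ : Fin m → El b′} →
         ρ ≈[ w ] ρ′ → τ ≈[ w ] τ′ → (∀ i j → Sim (proj₁ (ρ i)) (proj₁ (τ j)) (proj₁ (ρ′ i)) (proj₁ (τ′ j))) →
         (ρ +++ τ) ≈[ w ] (ρ′ +++ τ′)
  ≈-++ {b} {b′} {n} {m} {w} {ρ} {ρ′} {τ} {τ′} I J cross = record { matches = matches′ ; sims = sims′ }
    where
    matches′ : ∀ i → ∃[ ps ] Chain b b′ w [] [] ps × Match (from0 ps) (proj₁ ((ρ +++ τ) i)) (proj₁ ((ρ′ +++ τ′) i))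
    matches′ i with splitAt n i
    ... | inj₁ i = matches I i
    ... | inj₂ i = matches J i
    sims′ : ∀ i j → Sim (proj₁ ((ρ +++ τ) i)) (proj₁ ((ρ +++ τ) j)) (proj₁ ((ρ′ +++ τ′) i)) (proj₁ ((ρ′ +++ τ′) j))
    sims′ i j with splitAt n i | splitAt n j
    ... | inj₁ i | inj₁ j = sims I i j
    ... | inj₁ i | inj₂ j = cross i j
    ... | inj₂ i | inj₁ j = Sim-flip (cross j i)
    ... | inj₂ i | inj₂ j = sims J i j

  -- Translates of tuples

  shiftHead : ℤ → List ℚ → List ℚ
  shiftHead k []      = []
  shiftHead k (r ∷ u) = r ⊕ᶻ k ∷ u

  shiftFirst : ∀ {n} → ℤ → (Fin (suc n) → ℚ) → Fin (suc n) → ℚ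
  shiftFirst k rs = (rs fzero ⊕ᶻ k) ◂ (rs ∘ fsuc)

  shift : ∀ {b} → ℤ → El b → El b
  shift k (_ , n , rs , qs , as , m , l , refl , a0 , a1 , rest) =
    shiftHead k (word rs qs l) , n , shiftFirst k rs , qs , as , m , l , word-shift rs qs , inner n rs a0 , final n rs a1 , rest
    where
    word-shift : ∀ {n} (rs : Fin (suc n) → ℚ) (qs : Fin n → ℚ) →
                 shiftHead k (word rs qs l) ≡ word (shiftFirst k rs) qs l
    word-shift {zero}  rs qs = refl
    word-shift {suc n} rs qs = refl
    inner : ∀ n (rs : Fin (suc n) → ℚ) → (∀ i → A 0 (rs (initial i))) → ∀ i → A 0 (shiftFirst k rs (initial i))
    inner (suc n) rs a fzero    = A-⊕ᶻ 0 (rs fzero) k (a fzero)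
    inner (suc n) rs a (fsuc i) = a (fsuc i)
    final : ∀ n (rs : Fin (suc n) → ℚ) → A 1 (last rs) → A 1 (last (shiftFirst k rs))
    final zero    rs a = A-⊕ᶻ 1 (rs fzero) k a
    final (suc n) rs a = a

  shift-word : ∀ {b} k (x : El b) → proj₁ (shift k x) ≡ shiftHead k (proj₁ x)
  shift-word k (_ , n , rs , qs , as , m , l , refl , _) = refl

  -- All words of the tuple move by the same integer, so comparisons decided at the first letter
  -- persist; those decided later are untouched.
  ≈-shiftʳ : ∀ {b b′ n w} {ρ : Fin n → El b} {ρ′ : Fin n → El b′} l → ρ ≈[ w ] ρ′ → ρ ≈[ w ] (shift l ∘ ρ′)
  ≈-shiftʳ {b} {b′} {ρ = ρ} {ρ′} l I = record { matches = matches′ ; sims = sims′ }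
    where
    Match-shift : ∀ {ps σ τ} → Match ps σ τ → Match ps σ (shiftHead l τ)
    Match-shift (stop {r′ = r′} a a′ c) = stop a (A-⊕ᶻ 1 r′ l a′) c
    Match-shift (more {r′ = r′} a a′ m) = more a (A-⊕ᶻ 0 r′ l a′) m
    Sim-shift : ∀ {u v u′ v′} → Sim u v u′ v′ → Sim u v (shiftHead l u′) (shiftHead l v′)
    Sim-shift []         = []
    Sim-shift (less p q) = less p (⊕ᶻ-mono-< l q)
    Sim-shift (more p q) = more p (⊕ᶻ-mono-< l q)
    Sim-shift (same s)   = same s
    matches′ : ∀ i → ∃[ ps ] Chain b b′ _ [] [] ps × Match (from0 ps) (proj₁ (ρ i)) (proj₁ (shift l (ρ′ i)))
    matches′ i rewrite shift-word l (ρ′ i) = let ps , c , m = matches I i in ps , c , Match-shift m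
    sims′ : ∀ i j → Sim (proj₁ (ρ i)) (proj₁ (ρ j)) (proj₁ (shift l (ρ′ i))) (proj₁ (shift l (ρ′ j)))
    sims′ i j rewrite shift-word l (ρ′ i) | shift-word l (ρ′ j) = Sim-shift (sims I i j)

  ≈-shiftˡ : ∀ {b b′ n w} {ρ : Fin n → El b} {ρ′ : Fin n → El b′} k → ρ ≈[ w ] ρ′ → (shift k ∘ ρ) ≈[ w ] ρ′
  ≈-shiftˡ k I = ≈-sym (≈-shiftʳ k (≈-sym I))

  infix 4 _≪_
  data _≪_ : List ℚ → List ℚ → Set where
    heads< : ∀ {r s u v} → r Q.< s → r ∷ u ≪ s ∷ v

  ≪⇒Sim : ∀ {σ τ σ′ τ′} → σ ≪ τ → σ′ ≪ τ′ → Sim σ τ σ′ τ′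
  ≪⇒Sim (heads< p) (heads< q) = less p q

  ≪-shift : ∀ {σ τ} k l → σ ≪ shiftHead l τ → shiftHead k σ ≪ shiftHead (l ℤ.+ k) τ
  ≪-shift {τ = s ∷ _} k l (heads< p) = heads< (subst (_ Q.<_) (⊕ᶻ-assoc s l k) (⊕ᶻ-mono-< k p))

  Beyond : ∀ {b n m} → (Fin n → El b) → (Fin m → El b) → ℕ → Set
  Beyond ρ τ L = ∀ i j → proj₁ (ρ i) ≪ shiftHead (+ L) (proj₁ (τ j))

  -- Working with thresholds instead of single values lets one translation meet finitely many
  -- demands at once.
  eventually-∀ : ∀ {n} {P : Fin n → ℕ → Set} → (∀ i → ∃[ K ] ∀ L → K ℕ.≤ L → P i L) → ∃[ K ] ∀ L → K ℕ.≤ L → ∀ i → P i L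
  eventually-∀ {zero}  h = 0 , λ _ _ ()
  eventually-∀ {suc n} h with h fzero | eventually-∀ (h ∘ fsuc)
  ... | K , p | K′ , q = K ℕ.⊔ K′ , λ where
    L K≤L fzero    → p L (ℕₚ.≤-trans (ℕₚ.m≤m⊔n K K′) K≤L)
    L K≤L (fsuc i) → q L (ℕₚ.≤-trans (ℕₚ.m≤n⊔m K K′) K≤L) i

  beyond : ∀ {b n m} (ρ : Fin n → El b) (τ : Fin m → El b) → ∃[ K ] ∀ L → K ℕ.≤ L → Beyond ρ τ L
  beyond ρ τ = eventually-∀ λ i → eventually-∀ λ j → one (ρ i) (τ j)
    where
    nonempty : ∀ {b} (x : El b) → ∃[ r ] ∃[ u ] proj₁ x ≡ r ∷ u
    nonempty (_ , zero  , rs , _ , _ , _ , _ , refl , _) = _ , _ , refl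
    nonempty (_ , suc n , rs , _ , _ , _ , _ , refl , _) = _ , _ , refl
    one : ∀ {b} (x y : El b) → ∃[ K ] ∀ L → K ℕ.≤ L → proj₁ x ≪ shiftHead (+ L) (proj₁ y)
    one x y with nonempty x | nonempty y
    ... | r , u , e | s , v , e′ rewrite e | e′ with overtake r s
    ...   | K , h = K , λ L K≤L → heads< (h L K≤L)

  Before : ∀ {b n m} → (Fin n → El b) → (Fin m → El b) → Set
  Before ρ τ = ∀ i j → proj₁ (ρ i) ≪ proj₁ (τ j)

  Before-shift : ∀ {b n m L} {ρ : Fin n → El b} {τ : Fin m → El b} → Beyond ρ τ L → Before ρ (shift (+ L) ∘ τ)
  Before-shift {L = L} {ρ} {τ} p i j rewrite shift-word (+ L) (τ j) = p i j

  Before-shifts : ∀ {b n m L} {ρ : Fin n → El b} {τ : Fin m → El b} → Beyond ρ τ L →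
                  ∀ {k l} → + L ℤ.+ k ≡ l → Before (shift k ∘ ρ) (shift l ∘ τ)
  Before-shifts {L = L} {ρ} {τ} p {k} refl i j rewrite shift-word k (ρ i) | shift-word (+ L ℤ.+ k) (τ j) =
    ≪-shift {proj₁ (ρ i)} {proj₁ (τ j)} k (+ L) (p i j)

  module _ {b b′ : Bool} {n m : ℕ} {w : W} {ρ : Fin n → El b} {ρ′ : Fin n → El b′} {τ : Fin m → El b} {τ′ : Fin m → El b′}
           (I : ρ ≈[ w ] ρ′) (J : τ ≈[ w ] τ′) (p : Before ρ τ) (q : Before ρ′ τ′) where

    ≈-before : (ρ +++ τ) ≈[ w ] (ρ′ +++ τ′)
    ≈-before = ≈-++ I J λ i j → ≪⇒Sim (p i j) (q i j)

    ≈-after : (τ +++ ρ) ≈[ w ] (τ′ +++ ρ′)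
    ≈-after = ≈-++ J I λ i j → Sim-flip (≪⇒Sim (p j i) (q j i))

  E-total : ∀ {b m n} → Graph.V (𝔾 b) m → Graph.V (𝔾 b) n → Graph.E (𝔾 b) m n ⊎ m ≡ n ⊎ Graph.E (𝔾 b) n m
  E-total (x , vx , refl) (y , vy , refl) with compareᴾ x y
  ... | inj₁ p           = inj₁ (<⇒E vx vy p)
  ... | inj₂ (inj₁ refl) = inj₂ (inj₁ refl)
  ... | inj₂ (inj₂ p)    = inj₂ (inj₂ (<⇒E vy vx p))

  no-descent : ∀ {b} (g : ℕ → ℕ) → ¬ (∀ i → Graph.E (𝔾 b) (g (suc i)) (g i))
  no-descent {b} g desc with desc 0
  ... | _ , y , _ , (_ , e) , _ = go (⊏-wellFounded y) g e desc
    where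
    go : ∀ {y} → Acc _⊏_ y → (g : ℕ → ℕ) → codeᴾ y ≡ g 0 → ¬ (∀ i → Graph.E (𝔾 b) (g (suc i)) (g i))
    go {y} (acc rs) g e desc with desc 0
    ... | x , y′ , (vx , e₁) , (_ , e₂) , p with refl ← codeᴾ-injective y′ y (trans e₂ (sym e)) =
      go (rs (proj₁ vx , p)) (g ∘ suc) e₁ (desc ∘ suc)

-- The tree of ranks and the contradiction

baseRank : DefSet → DefRel → Ord
baseRank φD ψE = sup λ n → sup λ m → sup λ where
  zero    → rank (φD n)
  (suc _) → rank (ψE n m)

-- Index `0` holds the formulas, index `suc k` a tree for copying `k` elements. Larger indices are
-- higher in the order, so after copying a tuple of any length the ranks for the formulas are still
-- available.
totalRank : DefSet → DefRel → Ord
totalRank φD ψE = sup λ where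
  zero    → baseRank φD ψE
  (suc k) → rooms k

module Impossible (φD : DefSet) (ψ∼ ψE : DefRel)
                  (interp : (G : Graph) → IsInterpretation G (L G) φD ψ∼ ψE) where

  open Games (totalRank φD ψE)

  w₀ : W
  w₀ = under 0 root

  fits-E : ∀ n m → Fits (ψE n m) w₀
  fits-E n m = Fits-map (ψE n m) {h = under 0} <child (Fits-sup (ψE n m) n (Fits-sup (ψE n m) m (Fits-sup (ψE n m) 1 (Fits-rank (ψE n m)))))

  fits-D : ∀ n → Fits (φD n) w₀
  -- The first `0` after the arity `n` is an arbitrary second arity; the other one selects
  -- `rank (φD n)`.
  fits-D n = Fits-map (φD n) {h = under 0} <child (Fits-sup (φD n) n (Fits-sup (φD n) 0 (Fits-sup (φD n) 0 (Fits-rank (φD n)))))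

  counterpart : ∀ {n b} b′ (ρ : Fin n → El b) → Σ (Fin n → El b′) λ ρ′ → ρ ≈[ w₀ ] ρ′
  counterpart {n} b′ ρ
    with copy n 0 (subst (λ k → Room w₀ k (under (suc n) root)) (sym (ℕₚ.+-identityʳ n))
                         -- The whole subtree `rooms n`, at index `suc n`, lies above `w₀` at index
                         -- `0`.
                         (Room-rooms n {h = under (suc n)} <child (λ _ → <index (ℕ.s≤s ℕ.z≤n)))) ρ
  ... | v , w₀<v , ρ′ , I = ρ′ , ≈-lower (inj₁ w₀<v) I

  D : ∀ {b n} → (Fin n → El b) → Set
  D {b} {n} ρ = Sat (𝕃 b) (φD n) ρ

  infix 4 _⟶_
  _⟶_ : ∀ {b n m} → (Fin n → El b) → (Fin m → El b) → Set
  _⟶_ {b} {n} {m} ρ τ = Sat (𝕃 b) (ψE n m) (ρ +++ τ)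

  D-transfer : ∀ {b b′ n} {ρ : Fin n → El b} {ρ′ : Fin n → El b′} → ρ ≈[ w₀ ] ρ′ → D ρ → D ρ′
  D-transfer {n = n} = transfer (φD n) (fits-D n)

  module _ (b : Bool) where

    val : ∀ {n} (ρ : Fin n → El b) → D ρ → ℕ
    val ρ d = let _ , _ , _ , _ , _ , _ , f , _ = interp (𝔾 b) in f (_ , ρ) d

    val-V : ∀ {n} (ρ : Fin n → El b) d → Graph.V (𝔾 b) (val ρ d)
    val-V ρ d = let _ , _ , _ , _ , _ , _ , _ , v , _ = interp (𝔾 b) in v (_ , ρ) d

    val-onto : ∀ a → Graph.V (𝔾 b) a → ∃[ n ] Σ (Fin n → El b) λ ρ → Σ (D ρ) λ d → val ρ d ≡ a
    val-onto a va = let _ , _ , _ , _ , _ , _ , _ , _ , s , _ = interp (𝔾 b)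
                        (n , ρ) , d , e = s a va in n , ρ , d , e

    val-E : ∀ {n m} {ρ : Fin n → El b} {τ : Fin m → El b} (d : D ρ) (d′ : D τ) → ρ ⟶ τ ⇔ Graph.E (𝔾 b) (val ρ d) (val τ d′)
    val-E d d′ = let _ , _ , _ , _ , _ , _ , _ , _ , _ , _ , e = interp (𝔾 b) in e _ _ d d′

  iterate : ℤ → ℕ → ℤ
  iterate s zero    = + 0
  iterate s (suc i) = s ℤ.+ iterate s i

  iterate-pred : ∀ M i → + M ℤ.+ iterate (ℤ.- + M) (suc i) ≡ iterate (ℤ.- + M) i
  iterate-pred M i = trans (sym (ℤₚ.+-assoc (+ M) (ℤ.- + M) k)) (trans (cong (ℤ._+ k) (ℤₚ.+-inverseʳ (+ M))) (ℤₚ.+-identityˡ k))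
    where k = iterate (ℤ.- + M) i

  -- Otherwise the translates of ρ′, taken to the left or to the right, would represent an infinite
  -- descending sequence of vertices.
  shift-val : ∀ {b b′ n} {ρ : Fin n → El b} {ρ′ : Fin n → El b′} → ρ ≈[ w₀ ] ρ′ → (d : D ρ) →
              ∀ {L} → Beyond ρ ρ L → (d′ : D (shift (+ L) ∘ ρ)) → val b ρ d ≡ val b (shift (+ L) ∘ ρ) d′
  shift-val {b} {b′} {n} {ρ} {ρ′} I d {L} bey d′ =
    -- Distinct vertices are joined by an edge in some direction, and either direction leads to a
    -- descent in `𝔾 b′`.
    conclude (E-total (val-V b ρ d) (val-V b (shift (+ L) ∘ ρ) d′))
      (λ e → no-descent {b′} (λ i → val b′ (ρᵢ (ℤ.- + M) i) (dᵢ (ℤ.- + M) i)) (up e))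
      (λ e → no-descent {b′} (λ i → val b′ (ρᵢ (+ M) i) (dᵢ (+ M) i)) (down e))
    where
    M : ℕ
    M = proj₁ (beyond ρ′ ρ′)
    ρᵢ : ℤ → ℕ → Fin n → El b′
    ρᵢ s i = shift (iterate s i) ∘ ρ′
    I→ : ∀ s i → ρ ≈[ w₀ ] ρᵢ s i
    I→ s i = ≈-shiftʳ (iterate s i) I
    dᵢ : ∀ s i → D (ρᵢ s i)
    dᵢ s i = D-transfer (I→ s i) d
    before : Before ρ (shift (+ L) ∘ ρ)
    before = Before-shift {L = L} {ρ} {ρ} bey
    before′ : ∀ {k l} → + M ℤ.+ k ≡ l → Before (shift k ∘ ρ′) (shift l ∘ ρ′)
    before′ = Before-shifts {L = M} {ρ′} {ρ′} (proj₂ (beyond ρ′ ρ′) M ℕₚ.≤-refl)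
    up : Graph.E (𝔾 b) (val b ρ d) (val b (shift (+ L) ∘ ρ) d′) →
         ∀ i → Graph.E (𝔾 b′) (val b′ (ρᵢ (ℤ.- + M) (suc i)) (dᵢ (ℤ.- + M) (suc i))) (val b′ (ρᵢ (ℤ.- + M) i) (dᵢ (ℤ.- + M) i))
    -- This sequence moves to the left, so the term `suc i` stands to the term `i` as `ρ` stands to
    -- its translate.
    up e i = Equivalence.to (val-E b′ (dᵢ (ℤ.- + M) (suc i)) (dᵢ (ℤ.- + M) i))
      (transfer (ψE n n) {ρ = ρ +++ (shift (+ L) ∘ ρ)} {ρᵢ (ℤ.- + M) (suc i) +++ ρᵢ (ℤ.- + M) i} (fits-E n n)
        (≈-before (I→ (ℤ.- + M) (suc i)) (≈-shiftˡ (+ L) (I→ (ℤ.- + M) i)) before (before′ (iterate-pred M i)))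
        (Equivalence.from (val-E b d d′) e))
    down : Graph.E (𝔾 b) (val b (shift (+ L) ∘ ρ) d′) (val b ρ d) →
           ∀ i → Graph.E (𝔾 b′) (val b′ (ρᵢ (+ M) (suc i)) (dᵢ (+ M) (suc i))) (val b′ (ρᵢ (+ M) i) (dᵢ (+ M) i))
    down e i = Equivalence.to (val-E b′ (dᵢ (+ M) (suc i)) (dᵢ (+ M) i))
      (transfer (ψE n n) {ρ = (shift (+ L) ∘ ρ) +++ ρ} {ρᵢ (+ M) (suc i) +++ ρᵢ (+ M) i} (fits-E n n)
        (≈-after (I→ (+ M) i) (≈-shiftˡ (+ L) (I→ (+ M) (suc i))) before (before′ refl))
        (Equivalence.from (val-E b d′ d) e))
    conclude : ∀ {P Q R : Set} → P ⊎ Q ⊎ R → ¬ P → ¬ R → Q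
    conclude (inj₁ p)        ¬p _  = ⊥-elim (¬p p)
    conclude (inj₂ (inj₁ q)) _  _  = q
    conclude (inj₂ (inj₂ r)) _  ¬r = ⊥-elim (¬r r)

  -- Both `τ` and `τ′` are translated to the right, past `ρ` and `ρ′`. By `shift-val` their vertices
  -- do not change, and the concatenated tuples are then matched.
  E-transfer : ∀ {b b′ n m} {ρ : Fin n → El b} {ρ′ : Fin n → El b′} {τ : Fin m → El b} {τ′ : Fin m → El b′} →
               ρ ≈[ w₀ ] ρ′ → τ ≈[ w₀ ] τ′ → (dρ : D ρ) (dρ′ : D ρ′) (dτ : D τ) (dτ′ : D τ′) →
               Graph.E (𝔾 b) (val b ρ dρ) (val b τ dτ) → Graph.E (𝔾 b′) (val b′ ρ′ dρ′) (val b′ τ′ dτ′)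
  E-transfer {b} {b′} {n} {m} {ρ} {ρ′} {τ} {τ′} I J dρ dρ′ dτ dτ′ e =
    subst (Graph.E (𝔾 b′) (val b′ ρ′ dρ′)) (sym (shift-val (≈-sym J) dτ′ {M} (proj₂ past′) dτ″))
      (Equivalence.to (val-E b′ dρ′ dτ″)
        (transfer (ψE n m) {ρ = ρ +++ (shift (+ N) ∘ τ)} {ρ′ +++ (shift (+ M) ∘ τ′)} (fits-E n m)
          (≈-before I (≈-shiftˡ (+ N) (≈-shiftʳ (+ M) J)) (Before-shift {L = N} {ρ} {τ} (proj₁ past)) (Before-shift {L = M} {ρ′} {τ′} (proj₁ past′)))
          (Equivalence.from (val-E b dρ dτ⁺)
            (subst (Graph.E (𝔾 b) (val b ρ dρ)) (shift-val J dτ {N} (proj₂ past) dτ⁺) e))))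
    where
    -- Passing `ρ` puts the tuples in order; passing `τ` itself is what `shift-val` requires.
    both : ∀ {b} (ρ : Fin n → El b) (τ : Fin m → El b) → ∃[ L ] Beyond ρ τ L × Beyond τ τ L
    both ρ τ = let K , h = beyond ρ τ ; K′ , h′ = beyond τ τ
               in K ℕ.⊔ K′ , h _ (ℕₚ.m≤m⊔n K K′) , h′ _ (ℕₚ.m≤n⊔m K K′)
    N M : ℕ
    N = proj₁ (both ρ τ)
    M = proj₁ (both ρ′ τ′)
    past : Beyond ρ τ N × Beyond τ τ N
    past = proj₂ (both ρ τ)
    past′ : Beyond ρ′ τ′ M × Beyond τ′ τ′ M
    past′ = proj₂ (both ρ′ τ′)
    dτ⁺ : D (shift (+ N) ∘ τ)
    dτ⁺ = D-transfer (≈-shiftʳ (+ N) (≈-sym J)) dτ′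
    dτ″ : D (shift (+ M) ∘ τ′)
    dτ″ = D-transfer (≈-shiftʳ (+ M) J) dτ

  -- z > z′ > z″ > … where each point of 𝔾 true is also a point of 𝔾 false.
  descend : ∀ {z} → Acc _⊏_ z → ∀ {n} {ρ : Fin n → El false} {ρ′ : Fin n → El true} → ρ ≈[ w₀ ] ρ′ →
            (d : D ρ) (d′ : D ρ′) → Valid false z → codeᴾ z ≡ val false ρ d →
            ∀ {z′} → Valid true z′ → codeᴾ z′ ≡ val true ρ′ d′ → ¬ (z′ <ᴾ z)
  descend {z} (acc rs) {ρ = ρ} {ρ′} I d d′ vz e {z′} vz′ e′ p =
    let vz⁺ : Valid false z′
        vz⁺ = proj₁ vz′ , λ ()
        m , τ , c , e₁ = val-onto false (codeᴾ z′) (z′ , vz⁺ , refl)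
        τ′ , J = counterpart true τ
        -- Transferring `z′ <ᴾ z` makes `z″`, the vertex of `τ′`, smaller than `z′`, the vertex of
        -- `ρ′`.
        z″ , y , (vz″ , e₂) , (_ , e₃) , q =
          E-transfer J I c (D-transfer J c) d d′ (z′ , z , (vz⁺ , sym e₁) , (vz , e) , p)
    in descend (rs (proj₁ vz′ , p)) J c (D-transfer J c) vz⁺ (sym e₁) vz″ e₂
         (subst (z″ <ᴾ_) (codeᴾ-injective y z′ (trans e₃ (sym e′))) q)

  impossible : ⊥
  impossible =
    -- `ω^root` lies above every point of `𝔾 true`, so its counterpart is smaller, which starts the
    -- descent.
    let n , ρ , d , e = val-onto false (codeᴾ (root ∷ [])) (root ∷ [] , top , refl)
        ρ′ , I = counterpart true ρ
        z′ , vz′ , e′ = val-V true ρ′ (D-transfer I d)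
    in descend (⊏-wellFounded (root ∷ [])) I d (D-transfer I d) top (sym e) vz′ e′ (below-root z′ (proj₂ vz′ refl))
    where
    top : Valid false (root ∷ [])
    top = [] ∷ [] , λ ()
    below-root : ∀ z → All (_<ᴺ root) z → z <ᴾ root ∷ []
    below-root []      []      = _ , nil
    below-root (_ ∷ _) (p ∷ _) = _ , head p

mainTheorem1 : ¬ (Σ DefSet λ φD → Σ DefRel λ ψ∼ → Σ DefRel λ ψE → (G : Graph) → IsInterpretation G (L G) φD ψ∼ ψE)
mainTheorem1 (φD , ψ∼ , ψE , interp) = Impossible.impossible φD ψ∼ ψE interp
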